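{- A finite elation Laguerre plane $\mathbb{L}$ is ovoidal if and only if $\mathbb{L}\cong L(\overline{\mathcal{O}})$, where $\overline{\mathcal{O}}$ is an elementary dual pseudo-oval in $\mathrm{PG}(3n-1,q)$ (for some prime power $q$ and some $n\ge 1$).
   Context: A Laguerre plane is an incidence structure of points $\mathcal{P}$, lines $\mathcal{L}$ and circles $\mathcal{C}$ such that: (AX1) every point lies on a unique line; (AX2) a circle and a line meet in a unique point; (AX3) through three points, no two collinear, there is a unique circle; (AX4) if $P$ is a point on a circle $C$ and $Q$ is a point not on the line through $P$ and not on $C$, there is a unique circle through $P$ and $Q$ meeting $C$ only in $P$. In a finite Laguerre plane every circle has $s+1$ points for a constant $s$, the order. The kernel of a Laguerre plane is the group of automorphisms mapping every point to a point collinear with it (i.e. fixing every line). An elation Laguerre plane is a Laguerre plane whose kernel acts transitively on the circles. An ovoidal (finite) Laguerre plane is one that can be constructed (up to isomorphism) as follows, for some prime power $s$: take a cone $\mathcal{K}$ in $\mathrm{PG}(3,s)$ with vertex a point $V$ and base an oval ($s+1$ points, no three collinear) in a plane not containing $V$; points are the points of $\mathcal{K}\setminus\{V\}$, lines are the generators of $\mathcal{K}$, circles are the plane sections of $\mathcal{K}$ not containing $V$; incidence is natural. A pseudo-oval in $\mathrm{PG}(3n-1,q)$ is a set of $q^n+1$ subspaces of projective dimension $n-1$, any three of which span the whole space. A pseudo-oval is elementary if it is obtained from an oval of $\mathrm{PG}(2,q^n)$ by field reduction: under an $\mathbb{F}_q$-linear isomorphism $\mathbb{F}_{q^n}^3\cong\mathbb{F}_q^{3n}$,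 a point of $\mathrm{PG}(2,q^n)$ becomes an $(n-1)$-space of $\mathrm{PG}(3n-1,q)$. A dual pseudo-oval $\overline{\mathcal{O}}$ is the dual in $\mathrm{PG}(3n-1,q)$ of a pseudo-oval $\mathcal{O}$; it is a set of $q^n+1$ $(2n-1)$-spaces, and it is elementary if $\mathcal{O}$ is. Given a dual pseudo-oval $\overline{\mathcal{O}}$ in $H_\infty=\mathrm{PG}(3n-1,q)$, embed $H_\infty$ as a hyperplane of $\mathrm{PG}(3n,q)$. Then $L(\overline{\mathcal{O}})$ is the incidence structure with natural incidence whose points are the $2n$-spaces of $\mathrm{PG}(3n,q)$ meeting $H_\infty$ in an element of $\overline{\mathcal{O}}$, whose lines are the elements of $\overline{\mathcal{O}}$, and whose circles are the points of $\mathrm{PG}(3n,q)$ not in $H_\infty$. It is an elation Laguerre plane of order $q^n$. -}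

module Defs where

open import Level using (Level; _⊔_; 0ℓ) renaming (suc to lsuc)
open import Algebra.Bundles using (CommutativeRing)
open import Algebra.Module.Bundles.Raw using (RawLeftModule)
open import Algebra.Module.Morphism.Structures using (module LeftModuleMorphisms)
open import Algebra.Morphism.Structures using (module RingMorphisms)
import Algebra.Properties.Semiring.Sum as Sum
open import Data.Fin.Base using (Fin)
open import Data.Nat.Base as ℕ using (ℕ; suc)
open import Data.Product using (Σ-syntax; ∃-syntax; ∃!; _×_; _,_)
open import Data.Unit.Base using (⊤)
open import Data.Vec.Functional using (Vector; head; tail)
import Data.Vec.Functional.Relation.Binary.Equality.Setoid as VecEq
open import Function.Base using (_∘_)
open import Function.Bundles using (Inverse; _⇔_)
open import Relation.Binary.Bundles using (Setoid)
import Relation.Binary.Construct.On as On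
open import Relation.Binary.PropositionalEquality as ≡ using (_≡_; _≢_)
open import Relation.Nullary using (¬_)
open import Relation.Unary using (Pred; _∈_; _⊆_; _⊈_; _≐_; _∩_; ⋃)
open import Relation.Unary.Relation.Binary.Equality using (≐-setoid)

IsFinite : ∀ {c ℓ} → Setoid c ℓ → Set (c ⊔ ℓ)
IsFinite S = ∃[ n ] Inverse S (≡.setoid (Fin n))

record IncidenceStructure (c ℓ i : Level) : Set (lsuc (c ⊔ ℓ ⊔ i)) where
  infix 4 _onLine_ _onCircle_
  field
    points lines circles : Setoid c ℓ

  module P = Setoid points
  module L = Setoid lines
  module C = Setoid circles

  field
    _onLine_      : P.Carrier → L.Carrier → Set i
    _onCircle_    : P.Carrier → C.Carrier → Set i
    onLine-resp   : ∀ {p p′ l l′} → p P.≈ p′ → l L.≈ l′ → p onLine l → p′ onLine l′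
    onCircle-resp : ∀ {p p′ k k′} → p P.≈ p′ → k C.≈ k′ → p onCircle k → p′ onCircle k′

  Collinear : P.Carrier → P.Carrier → Set (c ⊔ i)
  Collinear p q = ∃[ l ] (p onLine l × q onLine l)

record IsLaguerrePlane {c ℓ i} (𝕃 : IncidenceStructure c ℓ i) : Set (c ⊔ ℓ ⊔ i) where
  open IncidenceStructure 𝕃
  field
    ax1 : ∀ p → ∃! L._≈_ (λ l → p onLine l)
    ax2 : ∀ k l → ∃! P._≈_ (λ p → p onCircle k × p onLine l)
    ax3 : ∀ p q r → ¬ Collinear p q → ¬ Collinear p r → ¬ Collinear q r →
          ∃! C._≈_ (λ k → p onCircle k × q onCircle k × r onCircle k)
    ax4 : ∀ p q k → p onCircle k → ¬ Collinear p q → ¬ (q onCircle k) →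
          ∃! C._≈_ (λ m → p onCircle m × q onCircle m ×
                          (∀ r → r onCircle k → r onCircle m → r P.≈ p))

record IsFiniteStructure {c ℓ i} (𝕃 : IncidenceStructure c ℓ i) : Set (c ⊔ ℓ) where
  open IncidenceStructure 𝕃
  field
    finitePoints  : IsFinite points
    finiteLines   : IsFinite lines
    finiteCircles : IsFinite circles

record Isomorphism {c ℓ i c′ ℓ′ i′}
                   (𝕃 : IncidenceStructure c ℓ i) (𝕄 : IncidenceStructure c′ ℓ′ i′)
                   : Set (c ⊔ ℓ ⊔ i ⊔ c′ ⊔ ℓ′ ⊔ i′) where
  private
    module 𝕃 = IncidenceStructure 𝕃
    module 𝕄 = IncidenceStructure 𝕄
  field
    onPoints  : Inverse 𝕃.points 𝕄.points
    onLines   : Inverse 𝕃.lines 𝕄.lines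
    onCircles : Inverse 𝕃.circles 𝕄.circles

  module OnPoints  = Inverse onPoints
  module OnLines   = Inverse onLines
  module OnCircles = Inverse onCircles

  field
    onLine-⇔   : ∀ p l → (p 𝕃.onLine l) ⇔ (OnPoints.to p 𝕄.onLine OnLines.to l)
    onCircle-⇔ : ∀ p k → (p 𝕃.onCircle k) ⇔ (OnPoints.to p 𝕄.onCircle OnCircles.to k)

module _ {c ℓ i} (𝕃 : IncidenceStructure c ℓ i) where
  open IncidenceStructure 𝕃

  Automorphism : Set (c ⊔ ℓ ⊔ i)
  Automorphism = Isomorphism 𝕃 𝕃

  InKernel : Automorphism → Set (c ⊔ i)
  InKernel α = ∀ p → Collinear p (Isomorphism.OnPoints.to α p)

  IsElation : Set (c ⊔ ℓ ⊔ i)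
  IsElation = ∀ k m → Σ[ α ∈ Automorphism ] (InKernel α × Isomorphism.OnCircles.to α k C.≈ m)

-- GF(q).  The order of a finite field is a prime power, and every prime power
-- is the order of a finite field that is unique up to isomorphism; so
-- quantifying over `FiniteField` is quantifying over prime powers.
record FiniteField : Set₁ where
  field
    commutativeRing : CommutativeRing 0ℓ 0ℓ

  open CommutativeRing commutativeRing public

  field
    0≉1         : ¬ (0# ≈ 1#)
    inverse     : ∀ x → ¬ (x ≈ 0#) → ∃[ y ] (x * y ≈ 1#)
    order       : ℕ
    enumeration : Inverse setoid (≡.setoid (Fin order))

module Geometry (F : FiniteField) where
  open FiniteField F
  open Sum semiring using (sum)
  open VecEq setoid public using (_≋_)

  V : ℕ → Set
  V m = Vector Carrier m

  infixl 6 _+ᵥ_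
  infixl 7 _*ᵥ_ _·_

  0ᵥ : ∀ {m} → V m
  0ᵥ _ = 0#

  -ᵥ_ : ∀ {m} → V m → V m
  (-ᵥ u) j = - u j

  _+ᵥ_ : ∀ {m} → V m → V m → V m
  (u +ᵥ v) j = u j + v j

  _*ᵥ_ : ∀ {m} → Carrier → V m → V m
  (a *ᵥ v) j = a * v j

  _·_ : ∀ {m} → V m → V m → Carrier
  u · v = sum (λ j → u j * v j)

  combination : ∀ {m k} → Vector Carrier k → Vector (V m) k → V m
  combination a b j = sum (λ i → a i * b i j)

  record Subspace (m : ℕ) : Set₁ where
    field
      carrier  : Pred (V m) 0ℓ
      resp     : ∀ {u v} → u ≋ v → u ∈ carrier → v ∈ carrier
      0-closed : 0ᵥ ∈ carrier
      +-closed : ∀ {u v} → u ∈ carrier → v ∈ carrier → u +ᵥ v ∈ carrier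
      *-closed : ∀ a {v} → v ∈ carrier → a *ᵥ v ∈ carrier

  record Basis {m} (U : Pred (V m) 0ℓ) (k : ℕ) : Set where
    field
      vectors     : Vector (V m) k
      inside      : ∀ i → vectors i ∈ U
      independent : ∀ a → combination a vectors ≋ 0ᵥ → a ≋ 0ᵥ
      spanning    : ∀ {u} → u ∈ U → ∃[ a ] (u ≋ combination a vectors)

  -- `Flat m k`: the subspaces of vector dimension k, that is, of projective
  -- dimension k - 1, in PG(m - 1, q).
  record Flat (m k : ℕ) : Set₁ where
    field
      subspace : Subspace m

    open Subspace subspace public

    field
      basis : Basis carrier k

  ⟦_⟧ : ∀ {m k} → Flat m k → Pred (V m) 0ℓ
  ⟦_⟧ = Flat.carrier

  flats : ∀ {a m k} {A : Set a} → (A → Flat m k) → Setoid a 0ℓ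
  flats {m = m} f = On.setoid (≐-setoid (V m) 0ℓ) (⟦_⟧ ∘ f)

  whole : ∀ {m} → Pred (V m) 0ℓ
  whole _ = ⊤

  infixl 6 _∨_
  _∨_ : ∀ {m} → Pred (V m) 0ℓ → Pred (V m) 0ℓ → Pred (V m) 0ℓ
  (U ∨ W) x = ∃[ u ] ∃[ w ] (u ∈ U × w ∈ W × x ≋ u +ᵥ w)

  infix 8 _ᗮ
  _ᗮ : ∀ {m} → Pred (V m) 0ℓ → Pred (V m) 0ℓ
  (U ᗮ) x = ∀ {u} → u ∈ U → u · x ≈ 0#

  record Oval {m} (π : Pred (V m) 0ℓ) : Set₁ where
    field
      point          : Fin (suc order) → Flat m 1
      inPlane        : ∀ i → ⟦ point i ⟧ ⊆ π
      distinct       : ∀ {i j} → ⟦ point i ⟧ ≐ ⟦ point j ⟧ → i ≡ j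
      noThreeOnALine : ∀ {i j k} → i ≢ j → i ≢ k → j ≢ k →
                        ¬ (Σ[ l ∈ Flat m 2 ]
                           (⟦ point i ⟧ ⊆ ⟦ l ⟧ × ⟦ point j ⟧ ⊆ ⟦ l ⟧ × ⟦ point k ⟧ ⊆ ⟦ l ⟧))

  module Cone (vertex : Flat 4 1) (π : Flat 4 3) (base : Oval ⟦ π ⟧) where
    private module O = Oval base

    generator : Fin (suc order) → Pred (V 4) 0ℓ
    generator i = ⟦ vertex ⟧ ∨ ⟦ O.point i ⟧

    -- The union of the points of the cone, as a set of vectors.
    cone : Pred (V 4) 0ℓ
    cone = ⋃[ i ∶ Fin (suc order) ] generator i

    record ConePoint : Set₁ where
      field
        flat      : Flat 4 1
        onCone    : ⟦ flat ⟧ ⊆ cone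
        notVertex : ¬ (⟦ flat ⟧ ≐ ⟦ vertex ⟧)

    record ConeLine : Set₁ where
      field
        flat        : Flat 4 2
        isGenerator : ∃[ i ] (⟦ flat ⟧ ≐ generator i)

    -- A circle is the section of the cone by `plane`; two planes with the same
    -- section give equal circles.
    record ConeCircle : Set₁ where
      field
        plane       : Flat 4 3
        avoidVertex : ⟦ vertex ⟧ ⊈ ⟦ plane ⟧

      section : Pred (V 4) 0ℓ
      section = cone ∩ ⟦ plane ⟧

    conePlane : IncidenceStructure (lsuc 0ℓ) 0ℓ 0ℓ
    conePlane = record
      { points        = flats ConePoint.flat
      ; lines         = flats ConeLine.flat
      ; circles       = On.setoid (≐-setoid (V 4) 0ℓ) ConeCircle.section
      ; _onLine_      = λ p l → ⟦ ConePoint.flat p ⟧ ⊆ ⟦ ConeLine.flat l ⟧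
      ; _onCircle_    = λ p k → ⟦ ConePoint.flat p ⟧ ⊆ ConeCircle.section k
      ; onLine-resp   = λ (_ , p′⊆p) (l⊆l′ , _) p⊆l x∈p′ → l⊆l′ (p⊆l (p′⊆p x∈p′))
      ; onCircle-resp = λ (_ , p′⊆p) (k⊆k′ , _) p⊆k x∈p′ → k⊆k′ (p⊆k (p′⊆p x∈p′))
      }

  record PseudoOval (n : ℕ) : Set₁ where
    field
      element   : Fin (suc (order ℕ.^ n)) → Flat (3 ℕ.* n) n
      distinct  : ∀ {i j} → ⟦ element i ⟧ ≐ ⟦ element j ⟧ → i ≡ j
      threeSpan : ∀ {i j k} → i ≢ j → i ≢ k → j ≢ k →
                  whole ⊆ ⟦ element i ⟧ ∨ ⟦ element j ⟧ ∨ ⟦ element k ⟧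

  -- The dual space of PG(3n - 1, q) is identified with PG(3n - 1, q) through
  -- the dot product, so that the dual of a subspace is its annihilator.
  record DualPseudoOval (n : ℕ) : Set₁ where
    field
      pseudoOval : PseudoOval n
      element    : Fin (suc (order ℕ.^ n)) → Flat (3 ℕ.* n) (2 ℕ.* n)
      isDual     : ∀ i → ⟦ element i ⟧ ≐ ⟦ PseudoOval.element pseudoOval i ⟧ ᗮ

  -- The hyperplane at infinity of PG(m, q) is where coordinate 0 vanishes;
  -- PG(m - 1, q) is embedded in it by u ↦ (0, u).
  H∞ : ∀ {m} → Pred (V (suc m)) 0ℓ
  H∞ x = head x ≈ 0#

  atInfinity : ∀ {m} → Pred (V m) 0ℓ → Pred (V (suc m)) 0ℓ
  atInfinity U x = x ∈ H∞ × tail x ∈ U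

  module FromDual {n : ℕ} (𝒪 : DualPseudoOval n) where
    private module 𝒪 = DualPseudoOval 𝒪

    record LPoint : Set₁ where
      field
        flat     : Flat (suc (3 ℕ.* n)) (suc (2 ℕ.* n))
        meets-H∞ : ∃[ i ] ((⟦ flat ⟧ ∩ H∞) ≐ atInfinity ⟦ 𝒪.element i ⟧)

    record LLine : Set₁ where
      field
        flat      : Flat (3 ℕ.* n) (2 ℕ.* n)
        isElement : ∃[ i ] (⟦ flat ⟧ ≐ ⟦ 𝒪.element i ⟧)

    record LCircle : Set₁ where
      field
        flat   : Flat (suc (3 ℕ.* n)) 1
        affine : ⟦ flat ⟧ ⊈ H∞

    structure : IncidenceStructure (lsuc 0ℓ) 0ℓ 0ℓ
    structure = record
      { points        = flats LPoint.flat
      ; lines         = flats LLine.flat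
      ; circles       = flats LCircle.flat
      ; _onLine_      = λ p l → atInfinity ⟦ LLine.flat l ⟧ ⊆ ⟦ LPoint.flat p ⟧
      ; _onCircle_    = λ p k → ⟦ LCircle.flat k ⟧ ⊆ ⟦ LPoint.flat p ⟧
      ; onLine-resp   = λ (p⊆p′ , _) (_ , l′⊆l) l⊆p (x∈H , x∈l′) → p⊆p′ (l⊆p (x∈H , l′⊆l x∈l′))
      ; onCircle-resp = λ (p⊆p′ , _) (_ , k′⊆k) k⊆p x∈k′ → p⊆p′ (k⊆p (k′⊆k x∈k′))
      }

-- The additive group of K^m, with scalars from F acting through ι : F → K.
restrictScalars : (F K : FiniteField) → (FiniteField.Carrier F → FiniteField.Carrier K) →
                  ℕ → RawLeftModule (FiniteField.Carrier F) 0ℓ 0ℓ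
restrictScalars F K ι m = record
  { Carrierᴹ = V m
  ; _≈ᴹ_     = _≋_
  ; _+ᴹ_     = _+ᵥ_
  ; _*ₗ_     = λ a v → ι a *ᵥ v
  ; 0ᴹ       = 0ᵥ
  ; -ᴹ_      = -ᵥ_
  }
  where open Geometry K

record IsElementary {F : FiniteField} {n : ℕ} (𝒪 : Geometry.PseudoOval F n) : Set₁ where
  private
    module F  = FiniteField F
    module GF = Geometry F
    module 𝒪  = GF.PseudoOval 𝒪
  field
    K       : FiniteField
    order-K : FiniteField.order K ≡ F.order ℕ.^ n

  private
    module K  = FiniteField K
    module GK = Geometry K

  field
    ι               : F.Carrier → K.Carrier
    ι-isHom         : RingMorphisms.IsRingHomomorphism F.rawRing K.rawRing ι
    φ               : GK.V 3 → GF.V (3 ℕ.* n)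
    φ-isIsomorphism : LeftModuleMorphisms.IsLeftModuleIsomorphism
                        (restrictScalars F K ι 3)
                        (restrictScalars F F (λ a → a) (3 ℕ.* n)) φ
    oval            : GK.Oval (GK.whole {3})

  reduced : Fin (suc K.order) → Pred (GF.V (3 ℕ.* n)) 0ℓ
  reduced j y = ∃[ x ] (x ∈ GK.⟦ GK.Oval.point oval j ⟧ × φ x GF.≋ y)

  field
    -- Both families enumerate the same set of subspaces.
    element-reduced : ∀ i → ∃[ j ] (GF.⟦ 𝒪.element i ⟧ ≐ reduced j)
    reduced-element : ∀ j → ∃[ i ] (GF.⟦ 𝒪.element i ⟧ ≐ reduced j)

IsOvoidal : ∀ {c ℓ i} → IncidenceStructure c ℓ i → Set (lsuc 0ℓ ⊔ c ⊔ ℓ ⊔ i)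
IsOvoidal 𝕃 =
  Σ[ F ∈ FiniteField ] let open Geometry F in
  Σ[ vertex ∈ Flat 4 1 ] Σ[ π ∈ Flat 4 3 ] Σ[ base ∈ Oval ⟦ π ⟧ ]
  (⟦ vertex ⟧ ⊈ ⟦ π ⟧ × Isomorphism 𝕃 (Cone.conePlane vertex π base))

IsFromElementaryDual : ∀ {c ℓ i} → IncidenceStructure c ℓ i → Set (lsuc 0ℓ ⊔ c ⊔ ℓ ⊔ i)
IsFromElementaryDual 𝕃 =
  Σ[ F ∈ FiniteField ] let open Geometry F in
  Σ[ n ∈ ℕ ] Σ[ 𝒪 ∈ DualPseudoOval n ]
  (1 ℕ.≤ n × IsElementary (DualPseudoOval.pseudoOval 𝒪) ×
   Isomorphism 𝕃 (FromDual.structure 𝒪))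

{-# OPTIONS --safe #-}
module Submission where

-- Both kinds of plane are compared with one model.  For an arc x in K³ take the
-- pairs (i , t), with t in K, as points and the vectors w of K³ as circles,
-- (i , t) lying on w when w · x i = t.  The pair is the cone point spanned by
-- t v + x i, where v spans the vertex, and w is the plane of the vectors s v + u
-- with s = w · u.  In PG(3n, q), w is the affine point (1 , Ψ w), where Ψ w is
-- the vector with φ u · Ψ w = τ (w · u) for all u in K³ and τ is a nonzero
-- F-linear functional on K; then Ψ w annihilates the reduction of x i exactly
-- when w · x i = 0, and (i , t) is the join of that annihilator with any
-- (1 , Ψ w) such that w · x i = t.  Dimension arguments are replaced by counting
-- vectors.

open import Defs
open import Level using (Level; 0ℓ)
open import Data.Fin.Base as Fin using (Fin; zero; suc; punchIn; punchOut; combine; funToFin; finToFun)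
open import Data.Fin.Properties as Fin using (any?; punchOut-injective; punchIn-punchOut; punchInᵢ≢i; punchIn-injective; injective⇒≤; finToFun-funToFin; funToFin-finToFin)
open import Data.Nat.Base as ℕ using (ℕ; zero; suc; s≤s; z≤n)
import Data.Nat.Properties as ℕ
open import Data.Product using (Σ-syntax; ∃-syntax; _×_; _,_; proj₁; proj₂)
open import Data.Unit.Base using (tt)
open import Data.Vec.Functional using (Vector; []; _∷_; head; tail)
import Data.Vec.Functional.Relation.Binary.Equality.Setoid as VecEq
open import Function.Base using (_∘_; id)
open import Function.Bundles using (Inverse; Injection; _⇔_; mk⇔; Equivalence)
open import Function.Definitions using (Congruent; Injective)
import Function.Construct.Composition as Comp
import Function.Construct.Symmetry as Symm
import Function.Properties.Inverse as Inv
open import Relation.Binary.Bundles using (Setoid)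
open import Relation.Binary.PropositionalEquality as ≡ using (_≡_; _≢_)
import Relation.Binary.Reasoning.Setoid as SetoidReasoning
open import Relation.Binary.Definitions using (Decidable)
open import Relation.Nullary using (¬_; yes; no; contradiction)
import Relation.Nullary.Decidable as Dec
open import Relation.Unary using (Pred; _∈_; _⊆_; _⊈_; _≐_; _∩_)
import Algebra.Properties.Semiring.Sum as Sum
import Algebra.Properties.Ring as RingProperties
open import Relation.Unary.Properties using (≐-sym; ≐-trans)
open import Algebra.Module.Morphism.Structures using (module LeftModuleMorphisms)
open import Algebra.Morphism.Structures using (module RingMorphisms)
import Algebra.Module.Morphism.Construct.Identity as ModuleIdentity
import Algebra.Morphism.Construct.Identity as RingIdentity

-- The two constructions lie on opposite sides of a duality: the circles of a cone are planes, that
-- is, functionals, while the circles of `L` are affine points. The model is phrased with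
-- functionals, and `Ψ` carries functionals on K³ to vectors over F. It is injective because `τ`
-- cannot vanish on all multiples of a nonzero element of a field, and then bijective because both
-- sides have q^(3n) elements. The coordinate t depends on the scale of `x i`. Hence an arc is a
-- family of vectors and not of projective points, and the two comparisons with the model have to
-- use the same vectors. From a cone to `L` the choice is n = 1 and K = F, an oval being a
-- pseudo-oval for n = 1. In the other direction the cone is taken over the extension field K.

private
  variable
    a ℓ a′ ℓ′ : Level

-- Bijections and the pigeonhole principle for finite setoids

module _ {S : Setoid a ℓ} {T : Setoid a′ ℓ′} where
  private
    module S = Setoid S
    module T = Setoid T

  bijective⇒inverse : (f : S.Carrier → T.Carrier) →
                      Congruent S._≈_ T._≈_ f → Injective S._≈_ T._≈_ f →
                      (∀ y → ∃[ x ] f x T.≈ y) → Inverse S T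
  bijective⇒inverse f cong inj surj = record
    { to        = f
    ; from      = proj₁ ∘ surj
    ; to-cong   = cong
    ; from-cong = λ {y} {y′} y≈y′ →
        inj (T.trans (proj₂ (surj y)) (T.trans y≈y′ (T.sym (proj₂ (surj y′)))))
    ; inverse   = (λ {y} x≈ → T.trans (cong x≈) (proj₂ (surj y)))
                , (λ {x} {y} y≈ → inj (T.trans (proj₂ (surj y)) y≈))
    }

  -- Pigeonhole: if `y` is missed, removing its position from the codomain leaves an injection from
  -- `Fin (suc n)` to `Fin n`.
  injective⇒surjective : ∀ {n} → Inverse S (≡.setoid (Fin n)) → Inverse T (≡.setoid (Fin n)) →
                         (f : S.Carrier → T.Carrier) →
                         Congruent S._≈_ T._≈_ f → Injective S._≈_ T._≈_ f →
                         ∀ y → ∃[ x ] f x T.≈ y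
  injective⇒surjective {zero}  I J f cong inj y with () ← Inverse.to J y
  injective⇒surjective {suc n} I J f cong inj y with any? (λ i → h i Fin.≟ J.to y)
    where
    module I = Inverse I
    module J = Inverse J
    h : Fin (suc n) → Fin (suc n)
    h i = J.to (f (I.from i))
  ... | yes (i , hi≡y) = _ , Injection.injective (Inv.Inverse⇒Injection J) hi≡y
  ... | no missed = contradiction (injective⇒≤ g-injective) ℕ.1+n≰n
    where
    module I = Inverse I
    module J = Inverse J
    y≢h : ∀ i → J.to y ≢ J.to (f (I.from i))
    y≢h i eq = missed (i , ≡.sym eq)
    g : Fin (suc n) → Fin n
    g i = punchOut (y≢h i)
    g-injective : ∀ {i j} → g i ≡ g j → i ≡ j
    g-injective {i} {j} eq =
      Injection.injective (Inv.Inverse⇒Injection (Symm.inverse I))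
        (inj (Injection.injective (Inv.Inverse⇒Injection J) (punchOut-injective (y≢h i) (y≢h j) eq)))

funToFin-cong : ∀ {m n} {f g : Fin m → Fin n} → (∀ i → f i ≡ g i) → funToFin f ≡ funToFin g
funToFin-cong {zero}  f≗g = ≡.refl
funToFin-cong {suc m} f≗g = ≡.cong₂ combine (f≗g zero) (funToFin-cong (f≗g ∘ suc))

-- Linear algebra over a finite field by counting

module LinearAlgebra (F : FiniteField) where
  open FiniteField F public hiding (zero)
  open Geometry F public
  open Sum semiring public using (sum; sum-cong-≋; ∑-distrib-+; ∑-comm; *-distribˡ-sum; *-distribʳ-sum)
  open RingProperties ring public using (-1*x≈-x; -‿distribˡ-*; x∙y⁻¹≈ε⇒x≈y)
  open VecEq setoid public using (≋-refl; ≋-sym; ≋-trans; ≋-setoid)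
  module ≈-R = SetoidReasoning setoid
  module ≋-R {m} = SetoidReasoning (≋-setoid m)

  private
    module E = Inverse enumeration
    E-injective = Injection.injective (Inv.Inverse⇒Injection enumeration)

  -- Positions in the enumeration decide equality; every later case distinction on whether a scalar
  -- vanishes rests on this.
  _≟_ : Decidable _≈_
  x ≟ y = Dec.map′ E-injective E.to-cong
                   (E.to x Fin.≟ E.to y)

  -- 0 and 1 occupy different positions. The bound also gives an oval at least three points, so that
  -- one or two indices can always be completed to a triple.
  2≤order : 2 ℕ.≤ order
  2≤order = two (E.to 0#) (E.to 1#) λ eq → 0≉1 (E-injective eq)
    where
    two : ∀ {n} (i j : Fin n) → i ≢ j → 2 ℕ.≤ n
    two {suc zero} zero zero i≢j = contradiction ≡.refl i≢j
    two {suc (suc n)} i j i≢j = s≤s (s≤s z≤n)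

  -- The source of all dimension counts: dimension m is read off from the number q^m of vectors.
  enumerationᵥ : ∀ m → Inverse (≋-setoid m) (≡.setoid (Fin (order ℕ.^ m)))
  enumerationᵥ m = record
    { to        = λ u → funToFin (E.to ∘ u)
    ; from      = λ k → E.from ∘ finToFun k
    ; to-cong   = λ u≋v → funToFin-cong (E.to-cong ∘ u≋v)
    ; from-cong = λ { ≡.refl → ≋-refl }
    ; inverse   = (λ {k} u≋ → ≡.trans (funToFin-cong (E.inverseˡ ∘ u≋)) (funToFin-finToFin {m} {order} k))
                , (λ {u} k≡ i → E.inverseʳ (≡.trans (≡.cong (λ k → finToFun k i) k≡) (finToFun-funToFin (E.to ∘ u) i)))
    }

  x*y≈0⇒y≈0 : ∀ {x y} → ¬ x ≈ 0# → x * y ≈ 0# → y ≈ 0#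
  x*y≈0⇒y≈0 {x} {y} x≉0 xy≈0 = let (z , xz≈1) = inverse x x≉0 in begin
    y           ≈⟨ *-identityˡ y ⟨
    1# * y      ≈⟨ *-congʳ xz≈1 ⟨
    x * z * y   ≈⟨ *-congʳ (*-comm x z) ⟩
    z * x * y   ≈⟨ *-assoc z x y ⟩
    z * (x * y) ≈⟨ *-congˡ xy≈0 ⟩
    z * 0#      ≈⟨ zeroʳ z ⟩
    0#          ∎
    where open ≈-R

  sum-zero : ∀ {n} {f : Vector Carrier n} → (∀ i → f i ≈ 0#) → sum f ≈ 0#
  sum-zero {zero}  f≈0 = refl
  sum-zero {suc n} f≈0 = trans (+-cong (f≈0 zero) (sum-zero (f≈0 ∘ suc))) (+-identityʳ 0#)

  private
    variable
      k l m : ℕ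

  +ᵥ-cong : {u u′ v v′ : V m} → u ≋ u′ → v ≋ v′ → u +ᵥ v ≋ u′ +ᵥ v′
  +ᵥ-cong u≋u′ v≋v′ i = +-cong (u≋u′ i) (v≋v′ i)

  *ᵥ-cong : ∀ {c d} {u v : V m} → c ≈ d → u ≋ v → c *ᵥ u ≋ d *ᵥ v
  *ᵥ-cong c≈d u≋v i = *-cong c≈d (u≋v i)

  combination-cong : {a a′ : V k} {b b′ : Vector (V m) k} →
                     a ≋ a′ → (∀ i → b i ≋ b′ i) → combination a b ≋ combination a′ b′
  combination-cong a≋a′ b≋b′ j = sum-cong-≋ λ i → *-cong (a≋a′ i) (b≋b′ i j)

  combination-congˡ : {a a′ : V k} (b : Vector (V m) k) → a ≋ a′ → combination a b ≋ combination a′ b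
  combination-congˡ b a≋a′ = combination-cong a≋a′ λ _ → ≋-refl

  combination-0 : (b : Vector (V m) k) → combination 0ᵥ b ≋ 0ᵥ
  combination-0 b j = sum-zero λ i → zeroˡ (b i j)

  combination-+ : (a a′ : V k) (b : Vector (V m) k) →
                  combination (a +ᵥ a′) b ≋ combination a b +ᵥ combination a′ b
  combination-+ a a′ b j = trans (sum-cong-≋ λ i → distribʳ (b i j) (a i) (a′ i))
                                 (∑-distrib-+ (λ i → a i * b i j) (λ i → a′ i * b i j))

  combination-* : ∀ c (a : V k) (b : Vector (V m) k) →
                  combination (c *ᵥ a) b ≋ c *ᵥ combination a b
  combination-* c a b j = trans (sum-cong-≋ λ i → *-assoc c (a i) (b i j))
                                (sym (*-distribˡ-sum c (λ i → a i * b i j)))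

  combination-assoc : (a : V k) (b : Vector (V l) k) (d : Vector (V m) l) →
                      combination (combination a b) d ≋ combination a (λ i → combination (b i) d)
  combination-assoc a b d j = begin
    sum (λ i → sum (λ h → a h * b h i) * d i j)
      ≈⟨ sum-cong-≋ (λ i → *-distribʳ-sum (d i j) (λ h → a h * b h i)) ⟩
    sum (λ i → sum (λ h → a h * b h i * d i j))
      ≈⟨ ∑-comm (λ i h → a h * b h i * d i j) ⟩
    sum (λ h → sum (λ i → a h * b h i * d i j))
      ≈⟨ sum-cong-≋ (λ h → trans (sum-cong-≋ λ i → *-assoc (a h) (b h i) (d i j))
                                 (sym (*-distribˡ-sum (a h) (λ i → b h i * d i j)))) ⟩
    sum (λ h → a h * sum (λ i → b h i * d i j)) ∎
    where open ≈-R

  ·-cong : {u u′ v v′ : V m} → u ≋ u′ → v ≋ v′ → u · v ≈ u′ · v′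
  ·-cong u≋u′ v≋v′ = sum-cong-≋ λ i → *-cong (u≋u′ i) (v≋v′ i)

  ·-comm : (u v : V m) → u · v ≈ v · u
  ·-comm u v = sum-cong-≋ λ i → *-comm (u i) (v i)

  -- A dot product is a combination of vectors of length 1, so the laws of `combination` apply.
  ·-+ˡ : (u v w : V m) → (u +ᵥ v) · w ≈ u · w + v · w
  ·-+ˡ u v w = combination-+ u v (λ i (_ : Fin 1) → w i) zero

  ·-*ˡ : ∀ c (u v : V m) → (c *ᵥ u) · v ≈ c * (u · v)
  ·-*ˡ c u v = combination-* c u (λ i (_ : Fin 1) → v i) zero

  ·-*ʳ : ∀ c (u v : V m) → u · (c *ᵥ v) ≈ c * (u · v)
  ·-*ʳ c u v = trans (·-comm u (c *ᵥ v)) (trans (·-*ˡ c v u) (*-congˡ (·-comm v u)))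

  ·-zeroˡ : (v : V m) → 0ᵥ · v ≈ 0#
  ·-zeroˡ v = sum-zero λ i → zeroˡ (v i)

  ·-zeroʳ : (v : V m) → v · 0ᵥ ≈ 0#
  ·-zeroʳ v = sum-zero λ i → zeroʳ (v i)

  ·-combination : (w : V m) (a : V k) (b : Vector (V m) k) →
                  w · combination a b ≈ a · (λ i → w · b i)
  ·-combination w a b = begin
    w · combination a b                  ≈⟨ ·-comm w (combination a b) ⟩
    combination a b · w                  ≈⟨ combination-assoc a b (λ i (_ : Fin 1) → w i) zero ⟩
    sum (λ i → a i * (b i · w))          ≈⟨ sum-cong-≋ (λ i → *-congˡ (·-comm (b i) w)) ⟩
    sum (λ i → a i * (w · b i))          ∎
    where open ≈-R

  δ : Vector (V m) m
  δ zero    zero    = 1#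
  δ zero    (suc j) = 0#
  δ (suc i) zero    = 0#
  δ (suc i) (suc j) = δ i j

  combination-δ : (a : V m) → combination a δ ≋ a
  combination-δ a zero    = trans (+-cong (*-identityʳ (a zero)) (sum-zero λ i → zeroʳ (a (suc i))))
                                  (+-identityʳ (a zero))
  combination-δ a (suc j) = trans (+-cong (zeroʳ (a zero)) (combination-δ (tail a) j))
                                  (+-identityˡ (a (suc j)))

  δ-sym : ∀ (i j : Fin m) → δ i j ≈ δ j i
  δ-sym zero    zero    = refl
  δ-sym zero    (suc j) = refl
  δ-sym (suc i) zero    = refl
  δ-sym (suc i) (suc j) = δ-sym i j

  ·-δ : (u : V m) (i : Fin m) → u · δ i ≈ u i
  ·-δ u i = trans (sum-cong-≋ λ j → *-congˡ (δ-sym i j)) (combination-δ u i)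

  record Independent (b : Vector (V m) k) : Set where
    constructor independent
    field
      trivial : ∀ a → combination a b ≋ 0ᵥ → a ≋ 0ᵥ

  open Independent public

  -- Written with the scalar -1, so that the closure laws of a subspace and the linearity of maps
  -- apply to it directly.
  _-ᵥ_ : V m → V m → V m
  u -ᵥ v = u +ᵥ (- 1#) *ᵥ v

  x-y≈0⇒x≈y : ∀ {x y} → x + - 1# * y ≈ 0# → x ≈ y
  x-y≈0⇒x≈y {x} {y} eq = x∙y⁻¹≈ε⇒x≈y x y (trans (+-congˡ (sym (-1*x≈-x y))) eq)

  x≈y⇒x-y≈0 : ∀ {x y} → x ≈ y → x + - 1# * y ≈ 0#
  x≈y⇒x-y≈0 {x} {y} x≈y = trans (+-cong x≈y (-1*x≈-x y)) (-‿inverseʳ y)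

  combination-minus : (a a′ : V k) (b : Vector (V m) k) →
                  combination (a -ᵥ a′) b ≋ combination a b -ᵥ combination a′ b
  combination-minus a a′ b = ≋-trans (combination-+ a _ b) (+ᵥ-cong ≋-refl (combination-* (- 1#) a′ b))

  ·-minusˡ : (u v w : V m) → (u -ᵥ v) · w ≈ u · w + - 1# * (v · w)
  ·-minusˡ u v w = trans (·-+ˡ u ((- 1#) *ᵥ v) w) (+-congˡ (·-*ˡ (- 1#) v w))

  independent⇒injective : {b : Vector (V m) k} → Independent b → ∀ {a a′} →
                          combination a b ≋ combination a′ b → a ≋ a′
  independent⇒injective {b = b} ind {a} {a′} eq i = x-y≈0⇒x≈y (trivial ind (a -ᵥ a′) comb≋0 i)
    where
    comb≋0 : combination (a -ᵥ a′) b ≋ 0ᵥ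
    comb≋0 = ≋-trans (combination-minus a a′ b) (x≈y⇒x-y≈0 ∘ eq)

  independent-∘ : {b : Vector (V l) k} {d : Vector (V m) l} → Independent b → Independent d →
                  Independent (λ i → combination (b i) d)
  independent-∘ {b = b} {d} b-ind d-ind = independent λ a eq →
    trivial b-ind a (trivial d-ind (combination a b) (≋-trans (combination-assoc a b d) eq))

  independent-cong : {b b′ : Vector (V m) k} → (∀ i → b i ≋ b′ i) → Independent b → Independent b′
  independent-cong b≋b′ ind = independent λ a eq → trivial ind a (≋-trans (combination-cong ≋-refl b≋b′) eq)

  -- Independence makes `a ↦ combination a b` an injective map between sets of the same finite size
  -- q^m, hence a surjective one.
  independent⇒spanning : {b : Vector (V m) m} → Independent b → ∀ u → ∃[ a ] combination a b ≋ u
  independent⇒spanning {m} {b} ind =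
    injective⇒surjective (enumerationᵥ m) (enumerationᵥ m) (λ a → combination a b)
      (combination-congˡ b) (independent⇒injective ind)

  -- The family spans, so each `δ i` is a combination of it, and pairing with `δ i` reads off
  -- coordinate i.
  dual-separates : {b : Vector (V m) m} → Independent b → ∀ {w w′ : V m} →
                   (∀ i → w · b i ≈ w′ · b i) → w ≋ w′
  dual-separates {b = b} ind {w} {w′} eq i = let (a , ab≋δ) = independent⇒spanning ind (δ i) in begin
      w i                     ≈⟨ ·-δ w i ⟨
      w · δ i                 ≈⟨ ·-cong (≋-refl {x = w}) ab≋δ ⟨
      w · combination a b     ≈⟨ ·-combination w a b ⟩
      a · (λ i → w · b i)     ≈⟨ ·-cong (≋-refl {x = a}) eq ⟩
      a · (λ i → w′ · b i)    ≈⟨ ·-combination w′ a b ⟨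
      w′ · combination a b    ≈⟨ ·-cong (≋-refl {x = w′}) ab≋δ ⟩
      w′ · δ i                ≈⟨ ·-δ w′ i ⟩
      w′ i                    ∎
      where open ≈-R

  -- Counting again: evaluation on the family is injective on q^m functionals, so every list of
  -- values is attained. This provides dual bases.
  dual-solution : {b : Vector (V m) m} → Independent b → ∀ t → ∃[ w ] (∀ i → w · b i ≈ t i)
  dual-solution {m} {b} ind =
    injective⇒surjective (enumerationᵥ m) (enumerationᵥ m) (λ w i → w · b i)
      (λ w≋w′ i → ·-cong w≋w′ (≋-refl {x = b i})) (dual-separates ind)

  -- The coefficient vectors of an independent family inject into those of a spanning one.
  independent⇒≤ : {b : Vector (V m) k} {d : Vector (V m) l} → Independent b →
                  (∀ i → ∃[ a ] b i ≋ combination a d) → k ℕ.≤ l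
  independent⇒≤ {k = k} {l} {b} {d} ind in-span = ℕ.≮⇒≥ λ l<k →
    ℕ.<⇒≱ (ℕ.^-monoʳ-< order 2≤order l<k) (injective⇒≤ {f = f} f-injective)
    where
    module Vk = Inverse (enumerationᵥ k)
    module Vl = Inverse (enumerationᵥ l)
    coeff : V k → V l
    coeff a = combination a (proj₁ ∘ in-span)
    coeff-injective : ∀ {a a′} → coeff a ≋ coeff a′ → a ≋ a′
    coeff-injective {a} {a′} eq = independent⇒injective ind (begin
      combination a b                                       ≈⟨ expand a ⟩
      combination (coeff a) d                               ≈⟨ combination-congˡ d eq ⟩
      combination (coeff a′) d                              ≈⟨ expand a′ ⟨
      combination a′ b                                      ∎)
      where
      open ≋-R
      expand : ∀ a → combination a b ≋ combination (coeff a) d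
      expand a = ≋-trans (combination-cong (≋-refl {x = a}) (proj₂ ∘ in-span))
                         (≋-sym (combination-assoc a (proj₁ ∘ in-span) d))
    f : Fin (order ℕ.^ k) → Fin (order ℕ.^ l)
    f i = Vl.to (coeff (Vk.from i))
    f-injective : ∀ {i j} → f i ≡ f j → i ≡ j
    f-injective eq =
      Injection.injective (Inv.Inverse⇒Injection (Symm.inverse (enumerationᵥ k)))
        (coeff-injective (Injection.injective (Inv.Inverse⇒Injection (enumerationᵥ l)) eq))

  span : (b : Vector (V m) k) → Independent b → Flat m k
  span b ind = record
    { subspace = record
      { carrier  = λ u → ∃[ a ] u ≋ combination a b
      ; resp     = λ u≋v (a , u≋ab) → a , ≋-trans (≋-sym u≋v) u≋ab
      ; 0-closed = 0ᵥ , ≋-sym (combination-0 b)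
      ; +-closed = λ (a , u≋ab) (a′ , v≋a′b) →
          a +ᵥ a′ , ≋-trans (+ᵥ-cong u≋ab v≋a′b) (≋-sym (combination-+ a a′ b))
      ; *-closed = λ c (a , u≋ab) → c *ᵥ a , ≋-trans (*ᵥ-cong refl u≋ab) (≋-sym (combination-* c a b))
      }
    ; basis = record
      { vectors     = b
      ; inside      = λ i → δ i , λ j →
          sym (trans (sum-cong-≋ λ h → *-comm (δ i h) (b h j)) (·-δ (λ h → b h j) i))
      ; independent = trivial ind
      ; spanning    = id
      }
    }

  basis-independent : (U : Flat m k) → Independent (Basis.vectors (Flat.basis U))
  basis-independent U = independent (Basis.independent (Flat.basis U))

-- Spare indices, and composing isomorphisms

∃-≢ : ∀ {n} → 1 ℕ.≤ n → (i : Fin (suc n)) → ∃[ j ] i ≢ j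
∃-≢ (s≤s _) i = punchIn i zero , punchInᵢ≢i i zero ∘ ≡.sym

-- Delete `i`, then delete what `j` has become; whatever remains avoids both after it is pushed
-- back.
∃-≢₂ : ∀ {n} → 2 ℕ.≤ n → {i j : Fin (suc n)} → i ≢ j → ∃[ k ] (i ≢ k × j ≢ k)
∃-≢₂ (s≤s (s≤s _)) {i} {j} i≢j = punchIn i (punchIn j′ zero) , punchInᵢ≢i i _ ∘ ≡.sym , λ j≡k →
    punchInᵢ≢i j′ zero (punchIn-injective i _ _ (≡.trans (≡.sym j≡k) (≡.sym (punchIn-punchOut i≢j))))
  where j′ = punchOut i≢j

module _ {c ℓ i c′ ℓ′ i′} {𝕃 : IncidenceStructure c ℓ i} {𝕄 : IncidenceStructure c′ ℓ′ i′} where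
  private
    module 𝕃 = IncidenceStructure 𝕃
    module 𝕄 = IncidenceStructure 𝕄

  ≅-sym : Isomorphism 𝕃 𝕄 → Isomorphism 𝕄 𝕃
  ≅-sym α = record
    { onPoints   = Symm.inverse onPoints
    ; onLines    = Symm.inverse onLines
    ; onCircles  = Symm.inverse onCircles
    ; onLine-⇔   = λ p l → mk⇔
        (λ inc → Equivalence.from (onLine-⇔ _ _)
          (𝕄.onLine-resp (𝕄.P.sym (OnPoints.strictlyInverseˡ p)) (𝕄.L.sym (OnLines.strictlyInverseˡ l)) inc))
        (λ inc → 𝕄.onLine-resp (OnPoints.strictlyInverseˡ p) (OnLines.strictlyInverseˡ l)
          (Equivalence.to (onLine-⇔ _ _) inc))
    ; onCircle-⇔ = λ p k → mk⇔
        (λ inc → Equivalence.from (onCircle-⇔ _ _)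
          (𝕄.onCircle-resp (𝕄.P.sym (OnPoints.strictlyInverseˡ p)) (𝕄.C.sym (OnCircles.strictlyInverseˡ k)) inc))
        (λ inc → 𝕄.onCircle-resp (OnPoints.strictlyInverseˡ p) (OnCircles.strictlyInverseˡ k)
          (Equivalence.to (onCircle-⇔ _ _) inc))
    }
    where open Isomorphism α

  ≅-trans : ∀ {c″ ℓ″ i″} {ℕ : IncidenceStructure c″ ℓ″ i″} →
            Isomorphism 𝕃 𝕄 → Isomorphism 𝕄 ℕ → Isomorphism 𝕃 ℕ
  ≅-trans α β = record
    { onPoints   = Comp.inverse α.onPoints β.onPoints
    ; onLines    = Comp.inverse α.onLines β.onLines
    ; onCircles  = Comp.inverse α.onCircles β.onCircles
    ; onLine-⇔   = λ p l → Comp.equivalence (α.onLine-⇔ p l) (β.onLine-⇔ _ _)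
    ; onCircle-⇔ = λ p k → Comp.equivalence (α.onCircle-⇔ p k) (β.onCircle-⇔ _ _)
    }
    where
    module α = Isomorphism α
    module β = Isomorphism β

-- Points, arcs, ovals and the model plane

module Arcs (F : FiniteField) where
  open LinearAlgebra F

  private
    variable
      k l m : ℕ

  ∷-cong : ∀ {s t} {u v : V m} → s ≈ t → u ≋ v → (s ∷ u) ≋ (t ∷ v)
  ∷-cong s≈t u≋v zero    = s≈t
  ∷-cong s≈t u≋v (suc j) = u≋v j

  combination-δˡ : (b : Vector (V m) k) (i : Fin k) → combination (δ i) b ≋ b i
  combination-δˡ b i j = trans (sum-cong-≋ λ h → *-comm (δ i h) (b h j)) (·-δ (λ h → b h j) i)

  combination₁ : (a : V 1) (b : Vector (V m) 1) → combination a b ≋ a zero *ᵥ b zero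
  combination₁ a b j = +-identityʳ _

  independent⇒≉0 : {b : Vector (V m) k} → Independent b → ∀ i → ¬ b i ≋ 0ᵥ
  independent⇒≉0 {b = b} ind i bi≋0 =
    0≉1 (trans (sym (trivial ind (δ i) (≋-trans (combination-δˡ b i) bi≋0) i)) (δᵢᵢ i))
    where
    δᵢᵢ : ∀ {n} (i : Fin n) → δ i i ≈ 1#
    δᵢᵢ zero    = refl
    δᵢᵢ (suc i) = δᵢᵢ i

  *ᵥ≋0⇒≋0 : ∀ {c} {u : V m} → ¬ c ≈ 0# → c *ᵥ u ≋ 0ᵥ → u ≋ 0ᵥ
  *ᵥ≋0⇒≋0 c≉0 cu≋0 i = x*y≈0⇒y≈0 c≉0 (cu≋0 i)

  ≉0⇒independent : {u : V m} → ¬ u ≋ 0ᵥ → Independent (λ (_ : Fin 1) → u)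
  ≉0⇒independent {u = u} u≉0 = independent λ { a eq zero → Dec.decidable-stable (a zero ≟ 0#) λ a≉0 →
    u≉0 (*ᵥ≋0⇒≋0 a≉0 (≋-trans (≋-sym (combination₁ a (λ _ → u))) eq)) }

  -- In a relation with nonzero coefficient at `u` one can divide by that coefficient and express
  -- `u` through `b`; otherwise the relation is one among `b` alone.
  independent-∷ : {u : V m} {b : Vector (V m) k} → Independent b →
                  (∀ a → ¬ u ≋ combination a b) → Independent (u ∷ b)
  independent-∷ {u = u} {b} ind u∉ .trivial a eq with a zero ≟ 0#
  ... | yes a₀≈0 = λ { zero → a₀≈0 ; (suc i) → trivial ind (tail a) tail≋0 i }
    where
    tail≋0 : combination (tail a) b ≋ 0ᵥ
    tail≋0 j = begin
      combination (tail a) b j               ≈⟨ +-identityˡ _ ⟨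
      0# + combination (tail a) b j          ≈⟨ +-congʳ (trans (*-congʳ a₀≈0) (zeroˡ (u j))) ⟨
      a zero * u j + combination (tail a) b j ≈⟨ eq j ⟩
      0#                                     ∎
      where open ≈-R
  ... | no  a₀≉0 = contradiction u≋ (u∉ ((- z) *ᵥ tail a))
    where
    z = proj₁ (inverse (a zero) a₀≉0)
    a₀z≈1 = proj₂ (inverse (a zero) a₀≉0)
    u≋ : u ≋ combination ((- z) *ᵥ tail a) b
    u≋ j = begin
      u j                                    ≈⟨ *-identityˡ (u j) ⟨
      1# * u j                               ≈⟨ *-congʳ (trans (*-comm z (a zero)) a₀z≈1) ⟨
      z * a zero * u j                       ≈⟨ *-assoc z (a zero) (u j) ⟩
      z * (a zero * u j)                     ≈⟨ +-inverseˡ-unique _ _ scaled ⟩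
      - (z * combination (tail a) b j)       ≈⟨ -‿distribˡ-* z _ ⟩
      - z * combination (tail a) b j         ≈⟨ combination-* (- z) (tail a) b j ⟨
      combination ((- z) *ᵥ tail a) b j      ∎
      where
      open ≈-R
      open RingProperties ring using (+-inverseˡ-unique)
      scaled : z * (a zero * u j) + z * combination (tail a) b j ≈ 0#
      scaled = trans (sym (distribˡ z _ _)) (trans (*-congˡ (eq j)) (zeroʳ z))

  -- The span of one vector, with membership witnessed by a scalar instead of a coefficient vector
  -- of length 1.
  point : (u : V m) → ¬ u ≋ 0ᵥ → Flat m 1
  point u u≉0 = record
    { subspace = record
      { carrier  = λ v → ∃[ c ] v ≋ c *ᵥ u
      ; resp     = λ v≋w (c , v≋cu) → c , ≋-trans (≋-sym v≋w) v≋cu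
      ; 0-closed = 0# , λ j → sym (zeroˡ (u j))
      ; +-closed = λ (c , v≋cu) (d , w≋du) →
          c + d , λ j → trans (+-cong (v≋cu j) (w≋du j)) (sym (distribʳ (u j) c d))
      ; *-closed = λ e (c , v≋cu) → e * c , λ j → trans (*-congˡ (v≋cu j)) (sym (*-assoc e c (u j)))
      }
    ; basis = record
      { vectors     = λ _ → u
      ; inside      = λ _ → 1# , λ j → sym (*-identityˡ (u j))
      ; independent = trivial (≉0⇒independent u≉0)
      ; spanning    = λ (c , v≋cu) → (λ _ → c) , ≋-trans v≋cu (≋-sym (combination₁ (λ _ → c) (λ _ → u)))
      }
    }

  module FlatProperties (U : Flat m k) where
    open Flat U
    open Basis basis

    combination-closed : ∀ a {b : Vector (V m) l} → (∀ i → b i ∈ carrier) → combination a b ∈ carrier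
    combination-closed {l = zero}  a b∈U = 0-closed
    combination-closed {l = suc l} a b∈U =
      +-closed (*-closed (a zero) (b∈U zero)) (combination-closed (tail a) (b∈U ∘ suc))

    -ᵥ-closed : ∀ {u v} → u ∈ carrier → v ∈ carrier → (u -ᵥ v) ∈ carrier
    -ᵥ-closed u∈U v∈U = +-closed u∈U (*-closed (- 1#) v∈U)

    *-closed⁻¹ : ∀ {c u} → ¬ c ≈ 0# → c *ᵥ u ∈ carrier → u ∈ carrier
    *-closed⁻¹ {c} {u} c≉0 cu∈U = let (z , cz≈1) = inverse c c≉0 in
      resp (λ j → trans (sym (*-assoc z c (u j)))
                        (trans (*-congʳ (trans (*-comm z c) cz≈1)) (*-identityˡ (u j))))
           (*-closed z cu∈U)

  open FlatProperties public using (combination-closed; -ᵥ-closed; *-closed⁻¹)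

  representative : Flat m 1 → V m
  representative P = Basis.vectors (Flat.basis P) zero

  module _ (P : Flat m 1) where
    private
      module P = Flat P
      module B = Basis P.basis

    representative∈ : representative P ∈ ⟦ P ⟧
    representative∈ = B.inside zero

    representative≉0 : ¬ representative P ≋ 0ᵥ
    representative≉0 = independent⇒≉0 (basis-independent P) zero

    ∈-point⇒multiple : ∀ {u} → u ∈ ⟦ P ⟧ → ∃[ c ] u ≋ c *ᵥ representative P
    ∈-point⇒multiple u∈P = let (a , u≋) = B.spanning u∈P in
      a zero , ≋-trans u≋ (combination₁ a B.vectors)

    multiple⇒∈-point : ∀ {u c} → u ≋ c *ᵥ representative P → u ∈ ⟦ P ⟧
    multiple⇒∈-point {c = c} u≋ = P.resp (≋-sym u≋) (P.*-closed c representative∈)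

    point-⊆ : (W : Flat m k) → representative P ∈ ⟦ W ⟧ → ⟦ P ⟧ ⊆ ⟦ W ⟧
    point-⊆ W p∈W u∈P = let (c , u≋) = ∈-point⇒multiple u∈P in
      Flat.resp W (≋-sym u≋) (Flat.*-closed W c p∈W)

  -- One inclusion suffices for points: the factor relating the two representatives is nonzero and
  -- can be inverted.
  multiple⇒≐ : (P Q : Flat m 1) → representative P ∈ ⟦ Q ⟧ → ⟦ P ⟧ ≐ ⟦ Q ⟧
  multiple⇒≐ P Q p∈Q with ∈-point⇒multiple Q p∈Q
  ... | c , p≋cq = point-⊆ P Q p∈Q , point-⊆ Q P
          (*-closed⁻¹ P c≉0 (Flat.resp P p≋cq (representative∈ P)))
    where
    c≉0 : ¬ c ≈ 0#
    c≉0 c≈0 = representative≉0 P (≋-trans p≋cq λ j → trans (*-congʳ c≈0) (zeroˡ _))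

  -- An oval with a chosen vector on each point. Nonvanishing and pairwise nonproportionality are
  -- implied, since every index or pair of indices extends to a triple.
  Arc : Vector (V m) (suc order) → Set
  Arc x = ∀ {i j k} → i ≢ j → i ≢ k → j ≢ k → Independent (x i ∷ x j ∷ x k ∷ [])

  module _ (p : Vector (V m) k) (x : Vector (V k) (suc order)) where
    private
      e : Vector (V m) (suc order)
      e i = combination (x i) p

      combination-triple : ∀ a i j h → combination a (e i ∷ e j ∷ e h ∷ []) ≋
                                       combination (combination a (x i ∷ x j ∷ x h ∷ [])) p
      combination-triple a i j h = ≋-trans
        (combination-cong {a = a} {b = e i ∷ e j ∷ e h ∷ []} {b′ = λ l → combination (triple l) p}
          ≋-refl λ { zero → ≋-refl ; (suc zero) → ≋-refl ; (suc (suc zero)) → ≋-refl })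
        (≋-sym (combination-assoc a triple p))
        where
        triple : Vector (V k) 3
        triple = x i ∷ x j ∷ x h ∷ []

    arc-image : Independent p → Arc x → Arc e
    arc-image ind arc {i} {j} {h} i≢j i≢h j≢h = independent λ a eq →
      trivial (arc i≢j i≢h j≢h) a (trivial ind _ (≋-trans (≋-sym (combination-triple a i j h)) eq))

    -- A relation among coordinate vectors is also one among the vectors that they describe. This
    -- brings the base oval of a cone from a plane of K⁴ down to K³.
    arc-preimage : Arc e → Arc x
    arc-preimage arc {i} {j} {h} i≢j i≢h j≢h = independent λ a eq →
      trivial (arc i≢j i≢h j≢h) a (≋-trans (combination-triple a i j h)
        (≋-trans (combination-congˡ p eq) (combination-0 p)))

  arc-cong : {x x′ : Vector (V m) (suc order)} → (∀ i → x i ≋ x′ i) → Arc x → Arc x′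
  arc-cong x≋x′ arc {i} {j} {h} i≢j i≢h j≢h = independent-cong
    (λ { zero → x≋x′ i ; (suc zero) → x≋x′ j ; (suc (suc zero)) → x≋x′ h }) (arc i≢j i≢h j≢h)

  -- Distinctness makes the span of `x j` and `x k` a genuine line; if `x i` were a combination of
  -- them, the three points would lie on it.
  oval⇒arc : {π : Pred (V m) 0ℓ} (O : Oval π) → Arc (representative ∘ Oval.point O)
  oval⇒arc O {i} {j} {k} i≢j i≢k j≢k =
    independent-∷ jk-independent λ a xi≋ →
      noThreeOnALine i≢j i≢k j≢k
        ( line
        , point-⊆ (O.point i) line (a , xi≋)
        , point-⊆ (O.point j) line (Basis.inside (Flat.basis line) zero)
        , point-⊆ (O.point k) line (Basis.inside (Flat.basis line) (suc zero)))
    where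
    open module O = Oval O using (noThreeOnALine)
    x = representative ∘ O.point
    jk-independent : Independent (x j ∷ x k ∷ [])
    jk-independent = independent-∷
      (independent-cong (λ { zero → ≋-refl }) (≉0⇒independent (representative≉0 (O.point k))))
      λ a xj≋ → j≢k (O.distinct (multiple⇒≐ (O.point j) (O.point k)
        (multiple⇒∈-point (O.point k) (≋-trans xj≋ (combination₁ a (x k ∷ []))))))
    line : Flat _ 2
    line = span (x j ∷ x k ∷ []) jk-independent

  module ArcProperties {x : Vector (V m) (suc order)} (arc : Arc x) where

    arc-nonzero : ∀ i → ¬ x i ≋ 0ᵥ
    arc-nonzero i =
      let (j , i≢j)       = ∃-≢ (ℕ.<⇒≤ 2≤order) i
          (k , i≢k , j≢k) = ∃-≢₂ 2≤order i≢j
      in independent⇒≉0 (arc i≢j i≢k j≢k) zero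

    -- For different indices a third one completes an independent triple, in which the coefficients
    -- of `x i` on the two sides are 1 and `c * 0#`.
    arc-injective : ∀ {i j c} → x i ≋ c *ᵥ x j → i ≡ j
    arc-injective {i} {j} {c} xi≋cxj with i Fin.≟ j
    ... | yes i≡j = i≡j
    ... | no  i≢j =
      let (k , i≢k , j≢k) = ∃-≢₂ 2≤order i≢j
          b     = x i ∷ x j ∷ x k ∷ []
          δ₀≋cδ₁ = independent⇒injective (arc i≢j i≢k j≢k) {δ zero} {c *ᵥ δ (suc zero)}
            (≋-trans (combination-δˡ b zero) (≋-trans xi≋cxj (≋-sym
              (≋-trans (combination-* c (δ (suc zero)) b) (*ᵥ-cong refl (combination-δˡ b (suc zero)))))))
      in contradiction (trans (sym (zeroʳ c)) (sym (δ₀≋cδ₁ zero))) 0≉1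

    arc⇒oval : {π : Pred (V m) 0ℓ} → (∀ i c → c *ᵥ x i ∈ π) → (∀ {u v} → u ≋ v → u ∈ π → v ∈ π) → Oval π
    arc⇒oval x∈π π-resp = record
      { point          = λ i → point (x i) (arc-nonzero i)
      ; inPlane        = λ i (c , u≋) → π-resp (≋-sym u≋) (x∈π i c)
      ; distinct       = λ {i} (⊆ⱼ , _) → arc-injective (proj₂ (⊆ⱼ (representative∈ (point (x i) (arc-nonzero i)))))
      ; noThreeOnALine = λ {i} {j} {k} i≢j i≢k j≢k (l , i⊆l , j⊆l , k⊆l) →
          let open Basis (Flat.basis l)
              x∈ : ∀ i → x i ∈ ⟦ point (x i) (arc-nonzero i) ⟧
              x∈ i = representative∈ (point (x i) (arc-nonzero i))
          -- Three independent vectors in the span of the two basis vectors of `l` would give 3 ≤ 2.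
          in ℕ.1+n≰n (independent⇒≤ {d = vectors} (arc i≢j i≢k j≢k) λ
               { zero → spanning (i⊆l (x∈ i))
               ; (suc zero) → spanning (j⊆l (x∈ j))
               ; (suc (suc zero)) → spanning (k⊆l (x∈ k)) })
      }

  module PlaneArc {x : Vector (V 3) (suc order)} (arc : Arc x) where
    open ArcProperties arc public

    solve₂ : ∀ {i j} → i ≢ j → ∀ s t → ∃[ w ] (w · x i ≈ s × w · x j ≈ t)
    solve₂ i≢j s t =
      let (k , i≢k , j≢k) = ∃-≢₂ 2≤order i≢j
          -- The value 0 at the third vector is arbitrary; that vector only completes a basis of K³.
          (w , w·)        = dual-solution (arc i≢j i≢k j≢k) (s ∷ t ∷ 0# ∷ [])
      in w , w· zero , w· (suc zero)

    solve₁ : ∀ i t → ∃[ w ] w · x i ≈ t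
    solve₁ i t =
      let (j , i≢j)    = ∃-≢ (ℕ.<⇒≤ 2≤order) i
          (w , w·i , _) = solve₂ i≢j t 0#
      in w , w·i

    arc-separates : ∀ {w w′} → (∀ i → w · x i ≈ w′ · x i) → w ≋ w′
    arc-separates eq =
      let (j , 0≢j)       = ∃-≢ (ℕ.<⇒≤ 2≤order) zero
          (k , 0≢k , j≢k) = ∃-≢₂ 2≤order 0≢j
      in dual-separates (arc 0≢j 0≢k j≢k) λ { zero → eq zero ; (suc zero) → eq j ; (suc (suc zero)) → eq k }

    -- If the indices differ, some functional is 0 at `x i` and 1 at `x j`. This will tell the
    -- elements of the dual pseudo-oval apart.
    polar-injective : ∀ {i j} → (∀ w → w · x i ≈ 0# → w · x j ≈ 0#) → i ≡ j
    polar-injective {i} {j} ⊥⊆⊥ with i Fin.≟ j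
    ... | yes i≡j = i≡j
    ... | no  i≢j = let (w , w·i , w·j) = solve₂ i≢j 0# 1# in
      contradiction (trans (sym (⊥⊆⊥ w w·i)) w·j) 0≉1

  -- The point (i , t) stands for the functionals w with value t at x i.
  arcPlane : Vector (V 3) (suc order) → IncidenceStructure 0ℓ 0ℓ 0ℓ
  arcPlane x = record
    { points        = ×-setoid (≡.setoid (Fin (suc order))) setoid
    ; lines         = ≡.setoid (Fin (suc order))
    ; circles       = ≋-setoid 3
    ; _onLine_      = λ (i , t) l → i ≡ l
    ; _onCircle_    = λ (i , t) w → w · x i ≈ t
    ; onLine-resp   = λ { (≡.refl , _) ≡.refl i≡l → i≡l }
    ; onCircle-resp = λ { {p = i , _} (≡.refl , t≈t′) w≋w′ w·x≈t →
        trans (·-cong (≋-sym w≋w′) (≋-refl {x = x i})) (trans w·x≈t t≈t′) }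
    }
    where open import Data.Product.Relation.Binary.Pointwise.NonDependent using (×-setoid)

-- The model plane as the plane of a cone

module ConeCoordinates (F : FiniteField) where
  open LinearAlgebra F
  open Arcs F

  module _ (vertex : Flat 4 1) (π : Flat 4 3) (base : Oval ⟦ π ⟧)
           (vertex⊈π : ⟦ vertex ⟧ ⊈ ⟦ π ⟧)
           (x : Vector (V 3) (suc order)) (arc : Arc x)
           (x-coordinates : ∀ i → representative (Oval.point base i) ≋ combination (x i) (Basis.vectors (Flat.basis π)))
           where
    open PlaneArc arc
    open Cone vertex π base

    private
      v : V 4
      v = representative vertex

      p : Vector (V 4) 3
      p = Basis.vectors (Flat.basis π)

      e : Vector (V 4) (suc order)
      e = representative ∘ Oval.point base

      frame : Vector (V 4) 4
      frame = v ∷ p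

    -- If `v` were a combination of the basis of `U`, the whole vertex would lie in `U`. Applied to
    -- `π` it gives the coordinate frame, and applied to the plane of a circle a second basis of K⁴.
    ∉⇒independent : ∀ {k} (U : Flat 4 k) → ⟦ vertex ⟧ ⊈ ⟦ U ⟧ → Independent (v ∷ Basis.vectors (Flat.basis U))
    ∉⇒independent U vertex⊈U = independent-∷ (basis-independent U) λ a v≋ →
      vertex⊈U (point-⊆ vertex U (Flat.resp U (≋-sym v≋) (combination-closed U a (Basis.inside (Flat.basis U)))))

    frame-independent : Independent frame
    frame-independent = ∉⇒independent π vertex⊈π

    opaque
      vec : V 4 → V 4
      vec y = combination y frame

      vec-cong : ∀ {y z} → y ≋ z → vec y ≋ vec z
      vec-cong = combination-congˡ frame

      vec-injective : ∀ {y z} → vec y ≋ vec z → y ≋ z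
      vec-injective = independent⇒injective frame-independent

      vec-surjective : ∀ u → ∃[ y ] vec y ≋ u
      vec-surjective = independent⇒spanning frame-independent

      vec-0 : vec 0ᵥ ≋ 0ᵥ
      vec-0 = combination-0 frame

      vec-*ᵥ : ∀ c y → vec (c *ᵥ y) ≋ c *ᵥ vec y
      vec-*ᵥ c y = combination-* c y frame

      vec-minus : ∀ y z → vec (y -ᵥ z) ≋ vec y -ᵥ vec z
      vec-minus y z = combination-minus y z frame

      vec-∷ : ∀ s y → vec (s ∷ y) ≋ s *ᵥ v +ᵥ combination y p
      vec-∷ s y j = refl

      vec-combination : ∀ {k} a (b : Vector (V 4) k) → vec (combination a b) ≋ combination a (vec ∘ b)
      vec-combination a b = combination-assoc a b frame

      vec-independent : ∀ {k} {b : Vector (V 4) k} → Independent b → Independent (vec ∘ b)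
      vec-independent ind = independent-∘ ind frame-independent

    vec-* : ∀ c s u → vec (c * s ∷ c *ᵥ u) ≋ c *ᵥ vec (s ∷ u)
    vec-* c s u = ≋-trans (vec-cong {z = c *ᵥ (s ∷ u)} λ { zero → refl ; (suc j) → refl }) (vec-*ᵥ c (s ∷ u))

    vec-vertex : ∀ s → vec (s ∷ 0ᵥ) ≋ s *ᵥ v
    vec-vertex s j = trans (vec-∷ s 0ᵥ j) (trans (+-congˡ (combination-0 p j)) (+-identityʳ _))

    vec-split : ∀ s c i → vec (s ∷ c *ᵥ x i) ≋ s *ᵥ v +ᵥ c *ᵥ e i
    vec-split s c i = ≋-trans (vec-∷ s (c *ᵥ x i)) (+ᵥ-cong (≋-refl {x = s *ᵥ v})
      (≋-trans (combination-* c (x i) p) (*ᵥ-cong refl (≋-sym (x-coordinates i)))))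

    ∈generator⇒ : ∀ {i u} → u ∈ generator i → ∃[ s ] ∃[ c ] u ≋ vec (s ∷ c *ᵥ x i)
    ∈generator⇒ {i} (u₁ , u₂ , u₁∈ , u₂∈ , u≋) =
      let (s , u₁≋) = ∈-point⇒multiple vertex u₁∈
          (c , u₂≋) = ∈-point⇒multiple (Oval.point base i) u₂∈
      in s , c , ≋-trans u≋ (≋-trans (+ᵥ-cong u₁≋ u₂≋) (≋-sym (vec-split s c i)))

    ⇒∈generator : ∀ {i u s c} → u ≋ vec (s ∷ c *ᵥ x i) → u ∈ generator i
    ⇒∈generator {i} {u} {s} {c} u≋ =
      s *ᵥ v , c *ᵥ e i , multiple⇒∈-point vertex ≋-refl , multiple⇒∈-point (Oval.point base i) ≋-refl ,
      ≋-trans u≋ (vec-split s c i)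

    pointVector : Fin (suc order) → Carrier → V 4
    pointVector i t = vec (t ∷ x i)

    ∈generator⇒≡ : ∀ {i j t} → pointVector i t ∈ generator j → i ≡ j
    ∈generator⇒≡ pt∈ = let (s , c , eq) = ∈generator⇒ pt∈ in arc-injective {c = c} (vec-injective eq ∘ suc)

    pointVector∈generator : ∀ i t → pointVector i t ∈ generator i
    pointVector∈generator i t = ⇒∈generator {s = t} {c = 1#}
      (vec-cong {t ∷ x i} {t ∷ 1# *ᵥ x i} λ { zero → refl ; (suc j) → sym (*-identityˡ (x i j)) })

    pointVector≉0 : ∀ i t → ¬ pointVector i t ≋ 0ᵥ
    pointVector≉0 i t pt≋0 = arc-nonzero i (vec-injective (≋-trans pt≋0 (≋-sym vec-0)) ∘ suc)

    pointFlat : Fin (suc order) → Carrier → Flat 4 1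
    pointFlat i t = point (pointVector i t) (pointVector≉0 i t)

    conePoint : Fin (suc order) × Carrier → ConePoint
    conePoint (i , t) = record
      { flat      = pointFlat i t
      ; onCone    = λ (c , u≋) → i , ⇒∈generator {s = c * t} (≋-trans u≋ (≋-sym (vec-* c t (x i))))
      ; notVertex = λ (pt⊆ , _) → arc-nonzero i λ j →
          let (s , pt≋) = ∈-point⇒multiple vertex (pt⊆ (representative∈ (pointFlat i t)))
          in vec-injective (≋-trans pt≋ (≋-sym (vec-vertex s))) (suc j)
      }

    conePoints : Inverse (IncidenceStructure.points (arcPlane x)) (IncidenceStructure.points conePlane)
    conePoints = bijective⇒inverse conePoint cong inj surj
      where
      cong : ∀ {a b} → proj₁ a ≡ proj₁ b × proj₂ a ≈ proj₂ b → ⟦ pointFlat (proj₁ a) (proj₂ a) ⟧ ≐ ⟦ pointFlat (proj₁ b) (proj₂ b) ⟧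
      cong {i , t} {_ , t′} (≡.refl , t≈t′) = multiple⇒≐ (pointFlat i t) (pointFlat i t′)
        (1# , λ j → trans (vec-cong (∷-cong t≈t′ (≋-refl {x = x i})) j) (sym (*-identityˡ _)))
      inj : ∀ {a b} → ⟦ pointFlat (proj₁ a) (proj₂ a) ⟧ ≐ ⟦ pointFlat (proj₁ b) (proj₂ b) ⟧ → proj₁ a ≡ proj₁ b × proj₂ a ≈ proj₂ b
      inj {i , t} {j , t′} (⊆ⱼ , _) with ⊆ⱼ (representative∈ (pointFlat i t))
      ... | c , pt≋ with vec-injective (≋-trans pt≋ (≋-sym (vec-* c t′ (x j))))
      ... | eq with arc-injective {i} {j} {c} (eq ∘ suc)
      ... | ≡.refl = ≡.refl , trans (eq zero) (trans (*-congʳ c≈1) (*-identityˡ t′))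
        where
        c≈1 : c ≈ 1#
        -- A functional with value 1 at `x i` extracts the scalar from `x i ≋ c *ᵥ x i`.
        c≈1 = let (w , w·x≈1) = solve₁ i 1# in begin
          c                ≈⟨ *-identityʳ c ⟨
          c * 1#           ≈⟨ *-congˡ w·x≈1 ⟨
          c * (w · x i)    ≈⟨ ·-*ʳ c w (x i) ⟨
          w · (c *ᵥ x i)   ≈⟨ ·-cong (≋-refl {x = w}) (eq ∘ suc) ⟨
          w · x i          ≈⟨ w·x≈1 ⟩
          1#               ∎
          where open ≈-R
      surj : ∀ P → ∃[ a ] ⟦ pointFlat (proj₁ a) (proj₂ a) ⟧ ≐ ⟦ ConePoint.flat P ⟧
      surj P =
        let open ConePoint P
            (i , r∈)     = onCone (representative∈ flat)
            (s , c , r≋) = ∈generator⇒ r∈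
            -- With c = 0 the point would be the vertex; otherwise dividing by c normalises its base
            -- component to `x i`.
            c≉0 : ¬ c ≈ 0#
            c≉0 c≈0 = notVertex (multiple⇒≐ flat vertex (multiple⇒∈-point vertex (≋-trans r≋
              (≋-trans (vec-cong (∷-cong refl λ j → trans (*-congʳ c≈0) (zeroˡ _))) (vec-vertex s)))))
            (z , cz≈1) = inverse c c≉0
        in (i , z * s) , ≐-sym (multiple⇒≐ flat (pointFlat i (z * s)) (c ,
             ≋-trans r≋ (≋-trans
               (vec-cong (∷-cong (trans (sym (*-identityˡ s)) (trans (*-congʳ (sym cz≈1)) (*-assoc c z s))) ≋-refl))
               (vec-* c (z * s) (x i)))))

    lineFlat : Fin (suc order) → Flat 4 2
    lineFlat i = span (v ∷ e i ∷ []) (independent-∷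
      (independent-cong (λ { zero → ≋-refl }) (≉0⇒independent (representative≉0 (Oval.point base i))))
      λ a v≋ → vertex⊈π (point-⊆ vertex π (Flat.resp π (≋-sym (≋-trans v≋ (combination₁ a (e i ∷ []))))
        (Flat.*-closed π (a zero) (Oval.inPlane base i (representative∈ (Oval.point base i)))))))

    lineFlat≐generator : ∀ i → ⟦ lineFlat i ⟧ ≐ generator i
    lineFlat≐generator i =
        (λ (a , u≋) → a zero *ᵥ v , a (suc zero) *ᵥ e i ,
           multiple⇒∈-point vertex ≋-refl , multiple⇒∈-point (Oval.point base i) ≋-refl ,
           ≋-trans u≋ (expand a))
      , (λ (u₁ , u₂ , u₁∈ , u₂∈ , u≋) →
           let (s , u₁≋) = ∈-point⇒multiple vertex u₁∈
               (c , u₂≋) = ∈-point⇒multiple (Oval.point base i) u₂∈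
           in (s ∷ c ∷ []) , ≋-trans u≋ (≋-trans (+ᵥ-cong u₁≋ u₂≋) (≋-sym (expand (s ∷ c ∷ [])))))
      where
      expand : ∀ a → combination a (v ∷ e i ∷ []) ≋ a zero *ᵥ v +ᵥ a (suc zero) *ᵥ e i
      expand a j = +-congˡ (+-identityʳ _)

    coneLines : Inverse (IncidenceStructure.lines (arcPlane x)) (IncidenceStructure.lines conePlane)
    coneLines = bijective⇒inverse
      (λ i → record { flat = lineFlat i ; isGenerator = i , lineFlat≐generator i })
      (λ { ≡.refl → id , id })
      (λ {i} {j} (⊆ⱼ , _) → ∈generator⇒≡ {t = 0#} (proj₁ (lineFlat≐generator j) (⊆ⱼ
        (proj₂ (lineFlat≐generator i) (pointVector∈generator i 0#)))))
      (λ l → let (i , l≐) = ConeLine.isGenerator l in i , ≐-trans (lineFlat≐generator i) (≐-sym l≐))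

    planeFlat : V 3 → Flat 4 3
    planeFlat w = span (λ k → vec (w k ∷ δ k)) (vec-independent graph-independent)
      where
      graph-independent : Independent (λ k → w k ∷ δ k)
      graph-independent = independent λ a eq → ≋-trans (≋-sym (combination-δ a)) (eq ∘ suc)

    combination-graph : ∀ w a → combination a (λ k → vec (w k ∷ δ k)) ≋ vec (a · w ∷ a)
    combination-graph w a = ≋-trans (≋-sym (vec-combination a (λ k → w k ∷ δ k)))
      (vec-cong {z = a · w ∷ a} λ { zero → refl ; (suc j) → combination-δ a j })

    ∈plane⇒ : ∀ w s y → vec (s ∷ y) ∈ ⟦ planeFlat w ⟧ → s ≈ y · w
    ∈plane⇒ w s y (a , eq) = let sy≋ = vec-injective (≋-trans eq (combination-graph w a)) in
      trans (sy≋ zero) (·-cong (≋-sym (sy≋ ∘ suc)) (≋-refl {x = w}))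

    ⇒∈plane : ∀ w s y {u} → s ≈ y · w → u ≋ vec (s ∷ y) → u ∈ ⟦ planeFlat w ⟧
    ⇒∈plane w s y s≈ u≋ =
      y , ≋-trans u≋ (≋-trans (vec-cong (∷-cong s≈ ≋-refl)) (≋-sym (combination-graph w y)))

    coneCircle : V 3 → ConeCircle
    coneCircle w = record
      { plane       = planeFlat w
      -- In frame coordinates the vertex is `1# ∷ 0ᵥ`, while over `0ᵥ` the graph of `w` contains
      -- only the value 0.
      ; avoidVertex = λ vertex⊆ → 0≉1 (trans (sym (·-zeroˡ w)) (sym (∈plane⇒ w 1# 0ᵥ
          (Flat.resp (planeFlat w) (≋-sym (≋-trans (vec-vertex 1#) λ j → *-identityˡ (v j)))
            (vertex⊆ (representative∈ vertex))))))
      }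

    plane-⊆ : ∀ {w w′} → w ≋ w′ → ⟦ planeFlat w ⟧ ⊆ ⟦ planeFlat w′ ⟧
    plane-⊆ {w} {w′} w≋w′ (a , u≋) = ⇒∈plane w′ (a · w) a (·-cong (≋-refl {x = a}) w≋w′) (≋-trans u≋ (combination-graph w a))

    module _ (E : Flat 4 3) (vertex⊈E : ⟦ vertex ⟧ ⊈ ⟦ E ⟧) where
      private
        module E = Flat E
        b = Basis.vectors E.basis

      -- `v` and the basis of `E` span K⁴, so `p h` is a multiple of `v` plus a vector of `E`;
      -- moving that multiple across explains the minus sign in the witness.
      graphVector∈ : ∀ h → ∃[ s ] vec (s ∷ δ h) ∈ ⟦ E ⟧
      graphVector∈ h = let (a , ≋ph) = independent⇒spanning (∉⇒independent E vertex⊈E) (p h) in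
        - a zero , E.resp (λ j → begin
          combination (tail a) b j
            ≈⟨ +-identityˡ _ ⟨
          0# + combination (tail a) b j
            ≈⟨ +-congʳ (trans (*-congʳ (-‿inverseˡ (a zero))) (zeroˡ (v j))) ⟨
          (- a zero + a zero) * v j + combination (tail a) b j
            ≈⟨ +-congʳ (distribʳ (v j) (- a zero) (a zero)) ⟩
          - a zero * v j + a zero * v j + combination (tail a) b j
            ≈⟨ +-assoc _ _ _ ⟩
          - a zero * v j + combination a (v ∷ b) j
            ≈⟨ +-congˡ (trans (≋ph j) (sym (combination-δˡ p h j))) ⟩
          - a zero * v j + combination (δ h) p j
            ≈⟨ vec-∷ (- a zero) (δ h) j ⟨
          vec (- a zero ∷ δ h) j ∎)
          (combination-closed E (tail a) (Basis.inside E.basis))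
        where open ≈-R

      slope : V 3
      slope = proj₁ ∘ graphVector∈

      slope-⊆ : ⟦ planeFlat slope ⟧ ⊆ ⟦ E ⟧
      slope-⊆ (a , u≋) = E.resp (≋-sym u≋) (combination-closed E a (proj₂ ∘ graphVector∈))

      -- Subtract the vector of the graph over the same tail: the difference is a multiple of `v`
      -- lying in `E`, and a nonzero factor would put the vertex into `E`.
      vec∈⇒ : ∀ y → vec y ∈ ⟦ E ⟧ → y zero ≈ tail y · slope
      vec∈⇒ y y∈E = x-y≈0⇒x≈y (Dec.decidable-stable (d ≟ 0#) λ d≉0 →
          vertex⊈E (point-⊆ vertex E (*-closed⁻¹ E d≉0 (E.resp difference difference∈E))))
        where
        z : V 4
        z = tail y · slope ∷ tail y
        d : Carrier
        d = y zero + - 1# * (tail y · slope)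
        difference∈E : (vec y -ᵥ vec z) ∈ ⟦ E ⟧
        difference∈E = -ᵥ-closed E y∈E (slope-⊆ (⇒∈plane slope (tail y · slope) (tail y) refl ≋-refl))
        y-z≋d∷0 : y -ᵥ z ≋ d ∷ 0ᵥ
        y-z≋d∷0 zero    = refl
        y-z≋d∷0 (suc j) = x≈y⇒x-y≈0 refl
        difference : vec y -ᵥ vec z ≋ d *ᵥ v
        difference = ≋-trans (≋-sym (vec-minus y z)) (≋-trans (vec-cong y-z≋d∷0) (vec-vertex d))

      ⊆-slope : ⟦ E ⟧ ⊆ ⟦ planeFlat slope ⟧
      ⊆-slope {u} u∈E = let (y , y≋u) = vec-surjective u in
        ⇒∈plane slope (y zero) (tail y) (vec∈⇒ y (E.resp (≋-sym y≋u) u∈E))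
          (≋-trans (≋-sym y≋u) (vec-cong {y} {y zero ∷ tail y} λ { zero → refl ; (suc j) → refl }))

    -- Circles are compared by their sections, so only the values of `w` along the arc are visible.
    -- They are enough, since three vectors of the arc form a basis.
    section-injective : ∀ w w′ → ConeCircle.section (coneCircle w) ⊆ ConeCircle.section (coneCircle w′) → w ≋ w′
    section-injective w w′ w⊆w′ = arc-separates λ i → trans (·-comm w (x i)) (trans
      (∈plane⇒ w′ (x i · w) (x i) (proj₂ (w⊆w′
        ((i , pointVector∈generator i (x i · w)) , ⇒∈plane w (x i · w) (x i) refl ≋-refl))))
      (·-comm (x i) w′))

    coneCircles : Inverse (IncidenceStructure.circles (arcPlane x)) (IncidenceStructure.circles conePlane)
    coneCircles = bijective⇒inverse coneCircle
      (λ w≋w′ → (λ (c , u∈) → c , plane-⊆ w≋w′ u∈) , (λ (c , u∈) → c , plane-⊆ (≋-sym w≋w′) u∈))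
      (λ {w} {w′} (w⊆w′ , _) → section-injective w w′ w⊆w′)
      (λ k → let open ConeCircle k in slope plane avoidVertex ,
        (λ (c , u∈) → c , slope-⊆ plane avoidVertex u∈) ,
        (λ (c , u∈) → c , ⊆-slope plane avoidVertex u∈))

    onLine⇔ : ∀ i t l → i ≡ l ⇔ (⟦ pointFlat i t ⟧ ⊆ ⟦ lineFlat l ⟧)
    onLine⇔ i t l = mk⇔
      (λ { ≡.refl → point-⊆ (pointFlat i t) (lineFlat i)
             (proj₂ (lineFlat≐generator i) (pointVector∈generator i t)) })
      (λ p⊆l → ∈generator⇒≡ (proj₁ (lineFlat≐generator l) (p⊆l (representative∈ (pointFlat i t)))))

    onCircle⇔ : ∀ i t w → w · x i ≈ t ⇔ (⟦ pointFlat i t ⟧ ⊆ ConeCircle.section (coneCircle w))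
    onCircle⇔ i t w = mk⇔
      (λ w·x≈t {u} u∈ → ConePoint.onCone (conePoint (i , t)) u∈ ,
        point-⊆ (pointFlat i t) (planeFlat w)
          (⇒∈plane w t (x i) (trans (sym w·x≈t) (·-comm w (x i))) ≋-refl) u∈)
      (λ p⊆w → trans (·-comm w (x i))
        (sym (∈plane⇒ w t (x i) (proj₂ (p⊆w (representative∈ (pointFlat i t)))))))

    arcPlane≅cone : Isomorphism (arcPlane x) conePlane
    arcPlane≅cone = record
      { onPoints   = conePoints
      ; onLines    = coneLines
      ; onCircles  = coneCircles
      ; onLine-⇔   = λ (i , t) → onLine⇔ i t
      ; onCircle-⇔ = λ (i , t) → onCircle⇔ i t
      }

-- Joins of an affine point with a subspace at infinity

module AffineJoin (F : FiniteField) where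
  open LinearAlgebra F
  open Arcs F

  private
    variable
      k m : ℕ

  -- The component at infinity of `y` after splitting off its multiple of the affine point `1# ∷ u`.
  offset : V m → V (suc m) → V m
  offset u y = tail y +ᵥ (- head y) *ᵥ u

  offset-cong : (u : V m) {y z : V (suc m)} → y ≋ z → offset u y ≋ offset u z
  offset-cong u y≋z j = +-cong (y≋z (suc j)) (*-congʳ (-‿cong (y≋z zero)))

  offset-+ : (u : V m) (y z : V (suc m)) → offset u (y +ᵥ z) ≋ offset u y +ᵥ offset u z
  offset-+ u y z j = begin
    y (suc j) + z (suc j) + - (y zero + z zero) * u j
      ≈⟨ +-congˡ (*-congʳ (-‿+-comm (y zero) (z zero))) ⟨
    y (suc j) + z (suc j) + (- y zero + - z zero) * u j
      ≈⟨ +-congˡ (distribʳ (u j) (- y zero) (- z zero)) ⟩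
    y (suc j) + z (suc j) + (- y zero * u j + - z zero * u j)
      ≈⟨ interchange _ _ _ _ ⟩
    offset u y j + offset u z j ∎
    where
    open ≈-R
    open RingProperties ring using (-‿+-comm)
    open import Algebra.Properties.CommutativeSemigroup +-commutativeSemigroup using (interchange)

  offset-* : ∀ c (u : V m) (y : V (suc m)) → offset u (c *ᵥ y) ≋ c *ᵥ offset u y
  offset-* c u y j = begin
    c * y (suc j) + - (c * y zero) * u j     ≈⟨ +-congˡ (*-congʳ (-‿distribʳ-* c (y zero))) ⟩
    c * y (suc j) + c * - y zero * u j       ≈⟨ +-congˡ (*-assoc c (- y zero) (u j)) ⟩
    c * y (suc j) + c * (- y zero * u j)     ≈⟨ distribˡ c _ _ ⟨
    c * offset u y j                         ∎
    where
    open ≈-R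
    open RingProperties ring using (-‿distribʳ-*)

  offset-H∞ : (u : V m) (y : V (suc m)) → y ∈ H∞ → offset u y ≋ tail y
  offset-H∞ u y y₀≈0 j = begin
    y (suc j) + - y zero * u j ≈⟨ +-congˡ (*-congʳ (trans (-‿cong y₀≈0) -0#≈0#)) ⟩
    y (suc j) + 0# * u j       ≈⟨ +-congˡ (zeroˡ (u j)) ⟩
    y (suc j) + 0#             ≈⟨ +-identityʳ _ ⟩
    y (suc j)                  ∎
    where
    open ≈-R
    open RingProperties ring using (-0#≈0#)

  offset-inverse : (u : V m) (y : V (suc m)) → tail y ≋ y zero *ᵥ u +ᵥ offset u y
  offset-inverse u y j = sym (begin
    y zero * u j + (y (suc j) + - y zero * u j) ≈⟨ x∙yz≈y∙xz _ _ _ ⟩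
    y (suc j) + (y zero * u j + - y zero * u j) ≈⟨ +-congˡ (distribʳ (u j) (y zero) (- y zero)) ⟨
    y (suc j) + (y zero + - y zero) * u j       ≈⟨ +-congˡ (*-congʳ (-‿inverseʳ (y zero))) ⟩
    y (suc j) + 0# * u j                        ≈⟨ +-congˡ (zeroˡ (u j)) ⟩
    y (suc j) + 0#                              ≈⟨ +-identityʳ _ ⟩
    y (suc j)                                   ∎)
    where
    open ≈-R
    open import Algebra.Properties.CommutativeSemigroup +-commutativeSemigroup using (x∙yz≈y∙xz)

  -- Shows how a join depends on its affine point: only the class of `u` modulo the part at infinity
  -- matters.
  offset-change : (u u′ : V m) (y : V (suc m)) → offset u′ y ≋ offset u y +ᵥ y zero *ᵥ (u -ᵥ u′)
  offset-change u u′ y j = begin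
    y (suc j) + - y zero * u′ j
      ≈⟨ +-congʳ (offset-inverse u y j) ⟩
    y zero * u j + offset u y j + - y zero * u′ j
      ≈⟨ xy∙z≈y∙xz _ _ _ ⟩
    offset u y j + (y zero * u j + - y zero * u′ j)
      ≈⟨ +-congˡ (+-congˡ (begin
           - y zero * u′ j         ≈⟨ -‿distribˡ-* (y zero) (u′ j) ⟨
           - (y zero * u′ j)       ≈⟨ -‿distribʳ-* (y zero) (u′ j) ⟩
           y zero * - u′ j         ≈⟨ *-congˡ (-1*x≈-x (u′ j)) ⟨
           y zero * (- 1# * u′ j)  ∎)) ⟩
    offset u y j + (y zero * u j + y zero * (- 1# * u′ j))
      ≈⟨ +-congˡ (distribˡ (y zero) _ _) ⟨
    offset u y j + y zero * (u j + - 1# * u′ j) ∎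
    where
    open ≈-R
    open RingProperties ring using (-‿distribʳ-*)
    open import Algebra.Properties.CommutativeSemigroup +-commutativeSemigroup using (xy∙z≈y∙xz)

  combination-∷ : (a : V k) (b : Vector (V m) k) → combination a (λ i → 0# ∷ b i) ≋ 0# ∷ combination a b
  combination-∷ a b zero    = sum-zero λ i → zeroʳ (a i)
  combination-∷ a b (suc j) = refl

  -- Given by a condition instead of a span, so that `1# ∷ u′` belongs to it by definition exactly
  -- when `u′ -ᵥ u` belongs to `W`.
  join : V m → Flat m k → Flat (suc m) (suc k)
  join u W = record
    { subspace = record
      { carrier  = λ y → offset u y ∈ ⟦ W ⟧
      ; resp     = λ y≋z → W.resp (offset-cong u y≋z)
      ; 0-closed = W.resp (≋-sym (offset-H∞ u 0ᵥ refl)) W.0-closed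
      ; +-closed = λ {y} {z} y∈ z∈ → W.resp (≋-sym (offset-+ u y z)) (W.+-closed y∈ z∈)
      ; *-closed = λ c {y} y∈ → W.resp (≋-sym (offset-* c u y)) (W.*-closed c y∈)
      }
    ; basis = record
      { vectors     = (1# ∷ u) ∷ λ i → 0# ∷ b i
      ; inside      = λ { zero → W.resp (≋-sym (λ j → x≈y⇒x-y≈0 refl)) W.0-closed
                        ; (suc i) → W.resp (≋-sym (offset-H∞ u (0# ∷ b i) refl)) (Basis.inside W.basis i) }
      ; independent = trivial (independent-∷ {u = 1# ∷ u} {b = λ i → 0# ∷ b i}
          (independent λ a eq → Basis.independent W.basis a (eq ∘ suc))
          λ a eq → 0≉1 (sym (trans (eq zero) (combination-∷ a b zero))))
      ; spanning    = λ {y} y∈ → let (a , eq) = Basis.spanning W.basis y∈ in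
          (y zero ∷ a) , λ
            { zero    → sym (trans (+-cong (*-identityʳ (y zero)) (combination-∷ a b zero)) (+-identityʳ (y zero)))
            ; (suc j) → trans (offset-inverse u y j) (+-congˡ (eq j)) }
      }
    }
    where
    module W = Flat W
    b = Basis.vectors W.basis

  join-⊆ : (u u′ : V m) (W W′ : Flat m k) → ⟦ W ⟧ ⊆ ⟦ W′ ⟧ → u -ᵥ u′ ∈ ⟦ W′ ⟧ → ⟦ join u W ⟧ ⊆ ⟦ join u′ W′ ⟧
  join-⊆ u u′ W W′ W⊆W′ u-u′∈ {y} y∈ = Flat.resp W′ (≋-sym (offset-change u u′ y))
    (Flat.+-closed W′ (W⊆W′ y∈) (Flat.*-closed W′ (y zero) u-u′∈))

  join∩H∞ : (u : V m) (W : Flat m k) → (⟦ join u W ⟧ ∩ H∞) ≐ atInfinity ⟦ W ⟧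
  join∩H∞ u W = (λ {y} (y∈ , y₀≈0) → y₀≈0 , Flat.resp W (offset-H∞ u y y₀≈0) y∈)
              , (λ {y} (y₀≈0 , y∈) → Flat.resp W (≋-sym (offset-H∞ u y y₀≈0)) y∈ , y₀≈0)

  module _ (U : Flat (suc m) (suc k)) (W : Flat m k) (U∩H∞≐W : (⟦ U ⟧ ∩ H∞) ≐ atInfinity ⟦ W ⟧) where
    private
      module U = Flat U
      module BU = Basis U.basis
      module BW = Basis (Flat.basis W)

    -- If every basis vector of `U` lay at infinity, k + 1 independent vectors would lie in the
    -- k-dimensional `W`. A basis vector off `H∞` is rescaled to have first coordinate 1.
    affineVector : ∃[ u ] (1# ∷ u) ∈ ⟦ U ⟧
    affineVector with any? (λ i → Dec.¬? (BU.vectors i zero ≟ 0#))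
    ... | yes (i , h≉0) = let (z , hz≈1) = inverse _ h≉0 in
          z *ᵥ tail (BU.vectors i) ,
          U.resp (λ { zero → trans (*-comm z _) hz≈1 ; (suc j) → refl }) (U.*-closed z (BU.inside i))
    ... | no  none = contradiction
          (independent⇒≤ {d = λ i → 0# ∷ BW.vectors i} (basis-independent U) λ i →
            let b₀≈0     = Dec.decidable-stable (BU.vectors i zero ≟ 0#) λ h≉0 → none (i , h≉0)
                (a , eq) = BW.spanning (proj₂ (proj₁ U∩H∞≐W (BU.inside i , b₀≈0)))
            in a , λ { zero → trans b₀≈0 (sym (combination-∷ a BW.vectors zero)) ; (suc j) → eq j })
          ℕ.1+n≰n

    -- Removing `y zero` times the affine point moves `y` to infinity without leaving `U`, where `U`
    -- is known to agree with `W`.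
    ≐-join : ∀ {u} → (1# ∷ u) ∈ ⟦ U ⟧ → ⟦ U ⟧ ≐ ⟦ join u W ⟧
    ≐-join {u} u∈U = U⊆ , ⊆U
      where
      infinite : V (suc _) → V (suc _)
      infinite y = 0# ∷ offset u y
      split : ∀ y → y ≋ y zero *ᵥ (1# ∷ u) +ᵥ infinite y
      split y zero    = sym (trans (+-identityʳ _) (*-identityʳ (y zero)))
      split y (suc j) = offset-inverse u y j
      ⊆U : ⟦ join u W ⟧ ⊆ ⟦ U ⟧
      ⊆U {y} y∈ = U.resp (≋-sym (split y))
        (U.+-closed (U.*-closed (y zero) u∈U) (proj₁ (proj₂ U∩H∞≐W (refl , y∈))))
      U⊆ : ⟦ U ⟧ ⊆ ⟦ join u W ⟧
      U⊆ {y} y∈U = proj₂ (proj₁ U∩H∞≐W (U.resp eq (U.+-closed y∈U (U.*-closed (- y zero) u∈U)) , refl))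
        where
        eq : y +ᵥ (- y zero) *ᵥ (1# ∷ u) ≋ infinite y
        eq zero    = trans (+-congˡ (*-identityʳ _)) (-‿inverseʳ (y zero))
        eq (suc j) = refl

-- Field reduction of functionals

module FieldReduction
  (F K : FiniteField) (n : ℕ) (order-K : FiniteField.order K ≡ FiniteField.order F ℕ.^ n)
  (ι : FiniteField.Carrier F → FiniteField.Carrier K)
  (ι-isHom : RingMorphisms.IsRingHomomorphism (FiniteField.rawRing F) (FiniteField.rawRing K) ι)
  (φ : Geometry.V K 3 → Geometry.V F (3 ℕ.* n))
  (φ-isIsomorphism : LeftModuleMorphisms.IsLeftModuleIsomorphism
    (restrictScalars F K ι 3) (restrictScalars F F (λ a → a) (3 ℕ.* n)) φ)
  where

  private
    module F = LinearAlgebra F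
    module K = LinearAlgebra K
    module FA = Arcs F
    module KA = Arcs K
    open F using () renaming (_≈_ to _≈ᶠ_; _≋_ to _≋ᶠ_; _·_ to _·ᶠ_; _+ᵥ_ to _+ᶠ_; _*ᵥ_ to _*ᶠ_)
    open K using (_≈_; _≋_; _·_; _+ᵥ_; _*ᵥ_; _-ᵥ_; δ)
    module ι = RingMorphisms.IsRingHomomorphism ι-isHom
    module φ = LeftModuleMorphisms.IsLeftModuleIsomorphism φ-isIsomorphism

  φ⁻¹ : F.V (3 ℕ.* n) → K.V 3
  φ⁻¹ y = proj₁ (φ.surjective y)

  φ∘φ⁻¹ : ∀ y → φ (φ⁻¹ y) ≋ᶠ y
  φ∘φ⁻¹ y = proj₂ (φ.surjective y) K.≋-refl

  -- A nonzero F-linear functional on K, in place of the trace.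
  nonzeroCoordinate : ∃[ r ] ¬ (φ (δ zero) r ≈ᶠ F.0#)
  nonzeroCoordinate = Fin.¬∀⟶∃¬ _ _ (λ r → φ (δ zero) r F.≟ F.0#) λ φδ≋0 →
    K.0≉1 (K.sym (φ.injective (F.≋-trans φδ≋0 (F.≋-sym φ.0ᴹ-homo)) zero))

  opaque
    τ : K.Carrier → F.Carrier
    τ a = φ (a *ᵥ δ zero) (proj₁ nonzeroCoordinate)

    τ-cong : ∀ {a b} → a ≈ b → τ a ≈ᶠ τ b
    τ-cong a≈b = φ.⟦⟧-cong (K.*ᵥ-cong a≈b (K.≋-refl {x = δ zero})) _

    τ-+ : ∀ a b → τ (a K.+ b) ≈ᶠ τ a F.+ τ b
    τ-+ a b = F.trans (φ.⟦⟧-cong (λ j → K.distribʳ (δ zero j) a b) _) (φ.+ᴹ-homo (a *ᵥ δ zero) (b *ᵥ δ zero) _)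

    τ-* : ∀ c a → τ (ι c K.* a) ≈ᶠ c F.* τ a
    τ-* c a = F.trans (φ.⟦⟧-cong (λ j → K.*-assoc (ι c) a (δ zero j)) _) (φ.*ₗ-homo c (a *ᵥ δ zero) _)

    τ-1 : ¬ τ K.1# ≈ᶠ F.0#
    τ-1 τ1≈0 = proj₂ nonzeroCoordinate
      (F.trans (φ.⟦⟧-cong (λ j → K.sym (K.*-identityˡ (δ zero j))) _) τ1≈0)

  τ-0 : τ K.0# ≈ᶠ F.0#
  τ-0 = RingProperties.x+x≈x⇒x≈0 F.ring (τ K.0#)
    (F.trans (F.sym (τ-+ K.0# K.0#)) (τ-cong (K.+-identityʳ K.0#)))

  τ-sum : ∀ {m} (f : Vector K.Carrier m) → τ (K.sum f) ≈ᶠ F.sum (τ ∘ f)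
  τ-sum {zero}  f = τ-0
  τ-sum {suc m} f = F.trans (τ-+ (f zero) (K.sum (tail f))) (F.+-congˡ (τ-sum (tail f)))

  -- For nonzero `a` the choice of its inverse for c would give `τ 1# ≈ 0#`.
  τ-nondegenerate : ∀ {a} → (∀ c → τ (c K.* a) ≈ᶠ F.0#) → a ≈ K.0#
  τ-nondegenerate {a} τ≈0 = Dec.decidable-stable (a K.≟ K.0#) λ a≉0 →
    let (z , az≈1) = K.inverse a a≉0 in
    τ-1 (F.trans (τ-cong (K.trans (K.sym az≈1) (K.*-comm a z))) (τ≈0 z))

  τ-separates : ∀ {a b} → (∀ c → τ (c K.* a) ≈ᶠ τ (c K.* b)) → a ≈ b
  τ-separates {a} {b} τ≈ = K.x∙y⁻¹≈ε⇒x≈y a b (τ-nondegenerate λ c →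
    RingProperties.+-identityˡ-unique F.ring _ (τ (c K.* b)) (begin
      τ (c K.* (a K.- b)) F.+ τ (c K.* b)   ≈⟨ τ-+ _ _ ⟨
      τ (c K.* (a K.- b) K.+ c K.* b)       ≈⟨ τ-cong (K.distribˡ c _ b) ⟨
      τ (c K.* (a K.- b K.+ b))             ≈⟨ τ-cong (K.*-congˡ (K.+-assoc a (K.- b) b)) ⟩
      τ (c K.* (a K.+ (K.- b K.+ b)))       ≈⟨ τ-cong (K.*-congˡ (K.+-congˡ (K.-‿inverseˡ b))) ⟩
      τ (c K.* (a K.+ K.0#))                ≈⟨ τ-cong (K.*-congˡ (K.+-identityʳ a)) ⟩
      τ (c K.* a)                           ≈⟨ τ≈ c ⟩
      τ (c K.* b)                           ∎))
    where open F.≈-R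

  φ-combination : ∀ {m} (c : F.V m) (b : Vector (K.V 3) m) →
                  φ (K.combination (ι ∘ c) b) ≋ᶠ F.combination c (φ ∘ b)
  φ-combination {zero}  c b = φ.0ᴹ-homo
  φ-combination {suc m} c b = F.≋-trans (φ.+ᴹ-homo _ _)
    (F.+ᵥ-cong (φ.*ₗ-homo (c zero) (b zero)) (φ-combination (tail c) (b ∘ suc)))

  -- The functional x ↦ τ (w · x) on K³, in coordinates over F.
  opaque
    Ψ : K.V 3 → F.V (3 ℕ.* n)
    Ψ w j = τ (w · φ⁻¹ (F.δ j))

    Ψ-cong : ∀ {w w′} → w ≋ w′ → Ψ w ≋ᶠ Ψ w′
    Ψ-cong w≋w′ j = τ-cong (K.·-cong w≋w′ (K.≋-refl {x = φ⁻¹ (F.δ j)}))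

    Ψ-+ : ∀ w w′ → Ψ (w +ᵥ w′) ≋ᶠ Ψ w +ᶠ Ψ w′
    Ψ-+ w w′ j = F.trans (τ-cong (K.·-+ˡ w w′ (φ⁻¹ (F.δ j)))) (τ-+ _ _)

    Ψ-* : ∀ c w → Ψ (ι c *ᵥ w) ≋ᶠ c *ᶠ Ψ w
    Ψ-* c w j = F.trans (τ-cong (K.·-*ˡ (ι c) w (φ⁻¹ (F.δ j)))) (τ-* c _)

    -- The vectors `φ⁻¹ (δ j)` form a basis of K³ over F, in which the coordinates of `x` are those
    -- of `φ x`; linearity of `τ` does the rest.
    φ·Ψ : ∀ x w → φ x ·ᶠ Ψ w ≈ᶠ τ (w · x)
    φ·Ψ x w = begin
      φ x ·ᶠ Ψ w                                     ≈⟨ F.sum-cong-≋ (λ j → τ-* (φ x j) (w · β j)) ⟨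
      F.sum (λ j → τ (ι (φ x j) K.* (w · β j)))      ≈⟨ τ-sum (λ j → ι (φ x j) K.* (w · β j)) ⟨
      τ ((ι ∘ φ x) · (λ j → w · β j))                ≈⟨ τ-cong (K.·-combination w (ι ∘ φ x) β) ⟨
      τ (w · K.combination (ι ∘ φ x) β)              ≈⟨ τ-cong (K.·-cong (K.≋-refl {x = w}) expand) ⟩
      τ (w · x)                                      ∎
      where
      open F.≈-R
      β : Vector (K.V 3) (3 ℕ.* n)
      β = φ⁻¹ ∘ F.δ
      expand : K.combination (ι ∘ φ x) β ≋ x
      expand = φ.injective (F.≋-trans (φ-combination (φ x) β)
        (F.≋-trans (F.combination-cong (F.≋-refl {x = φ x}) (φ∘φ⁻¹ ∘ F.δ)) (F.combination-δ (φ x))))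

  Ψ-minus : ∀ w w′ → Ψ (w -ᵥ w′) ≋ᶠ Ψ w F.-ᵥ Ψ w′
  Ψ-minus w w′ = F.≋-trans (Ψ-+ w ((K.- K.1#) *ᵥ w′)) (F.+ᵥ-cong (F.≋-refl {x = Ψ w})
    -- The scalar -1 of K is the image under `ι` of the one of F, so F-linearity of `Ψ` covers
    -- differences.
    (F.≋-trans (Ψ-cong (K.*ᵥ-cong (K.sym (K.trans (ι.-‿homo F.1#) (K.-‿cong ι.1#-homo))) (K.≋-refl {x = w′})))
               (Ψ-* (F.- F.1#) w′)))

  -- Pairing with `φ (c *ᵥ δ i)` yields `τ (c * w i)` for every c, which determines `w i`.
  Ψ-injective : ∀ {w w′} → Ψ w ≋ᶠ Ψ w′ → w ≋ w′
  Ψ-injective {w} {w′} eq i = τ-separates λ c → begin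
      τ (c K.* w i)                 ≈⟨ coordinate c w ⟨
      φ (c *ᵥ δ i) ·ᶠ Ψ w           ≈⟨ F.·-cong (F.≋-refl {x = φ (c *ᵥ δ i)}) eq ⟩
      φ (c *ᵥ δ i) ·ᶠ Ψ w′          ≈⟨ coordinate c w′ ⟩
      τ (c K.* w′ i)                ∎
    where
    open F.≈-R
    coordinate : ∀ c w → φ (c *ᵥ δ i) ·ᶠ Ψ w ≈ᶠ τ (c K.* w i)
    coordinate c w = F.trans (φ·Ψ (c *ᵥ δ i) w)
      (τ-cong (K.trans (K.·-*ʳ c w (δ i)) (K.*-congˡ (K.·-δ w i))))

  -- Both spaces have (q^n)^3 = q^(3n) elements.
  Ψ-surjective : ∀ y → ∃[ w ] Ψ w ≋ᶠ y
  Ψ-surjective = injective⇒surjective (K.enumerationᵥ 3)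
    (≡.subst (λ q → Inverse (F.≋-setoid (3 ℕ.* n)) (≡.setoid (Fin q))) same-size (F.enumerationᵥ (3 ℕ.* n)))
    Ψ Ψ-cong Ψ-injective
    where
    same-size : F.order ℕ.^ (3 ℕ.* n) ≡ K.order ℕ.^ 3
    same-size = ≡.trans (≡.cong (F.order ℕ.^_) (ℕ.*-comm 3 n))
      (≡.trans (≡.sym (ℕ.^-*-assoc F.order n 3)) (≡.cong (ℕ._^ 3) (≡.sym order-K)))

  -- Orthogonality over F to the single vector `x` would give only `τ (w · x) ≈ 0#`. A reduced point
  -- contains all K-multiples of `x`, which upgrades this to vanishing of `w · x`.
  Ψ∈ᗮ⇒ : ∀ {w} {U : Pred (K.V 3) 0ℓ} {x} → (∀ c → c *ᵥ x ∈ U) →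
         Ψ w ∈ (λ y → ∃[ u ] (u ∈ U × φ u ≋ᶠ y)) F.ᗮ → w · x ≈ K.0#
  Ψ∈ᗮ⇒ {w} {U} {x} x∈U Ψw∈ᗮ = τ-nondegenerate λ c → F.trans
    (τ-cong (K.sym (K.·-*ʳ c w x))) (F.trans (F.sym (φ·Ψ (c *ᵥ x) w))
    (Ψw∈ᗮ (c *ᵥ x , x∈U c , F.≋-refl)))

  ⇒Ψ∈ᗮ : ∀ {w} {U : Pred (K.V 3) 0ℓ} {x} → (∀ {u} → u ∈ U → ∃[ c ] u ≋ c *ᵥ x) →
         w · x ≈ K.0# → Ψ w ∈ (λ y → ∃[ u ] (u ∈ U × φ u ≋ᶠ y)) F.ᗮ
  ⇒Ψ∈ᗮ {w} {U} {x} multiples w·x≈0 {y} (u , u∈U , φu≋y) = let (c , u≋cx) = multiples u∈U in begin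
      y ·ᶠ Ψ w          ≈⟨ F.·-cong φu≋y (F.≋-refl {x = Ψ w}) ⟨
      φ u ·ᶠ Ψ w        ≈⟨ φ·Ψ u w ⟩
      τ (w · u)         ≈⟨ τ-cong (K.·-cong (K.≋-refl {x = w}) u≋cx) ⟩
      τ (w · (c *ᵥ x))  ≈⟨ τ-cong (K.trans (K.·-*ʳ c w x) (K.trans (K.*-congˡ w·x≈0) (K.zeroʳ c))) ⟩
      τ K.0#            ≈⟨ τ-0 ⟩
      F.0#              ∎
    where open F.≈-R

ᗮ-cong : ∀ (F : FiniteField) {m} (let open Geometry F) {U W : Pred (V m) 0ℓ} → U ≐ W → U ᗮ ≐ W ᗮ
ᗮ-cong F (U⊆W , W⊆U) = (λ x∈ u∈W → x∈ (W⊆U u∈W)) , (λ x∈ u∈U → x∈ (U⊆W u∈U))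

-- The model plane as the plane of an elementary dual pseudo-oval

module ElementaryDual {F : FiniteField} {n : ℕ} (𝒪 : Geometry.DualPseudoOval F n)
                      (elementary : IsElementary (Geometry.DualPseudoOval.pseudoOval 𝒪)) where
  open IsElementary elementary

  private
    module F = LinearAlgebra F
    module K = LinearAlgebra K
    module FA = Arcs F
    module KA = Arcs K
    module 𝒪 = Geometry.DualPseudoOval 𝒪
    module P = Geometry.PseudoOval 𝒪.pseudoOval
    module O = Geometry.Oval oval
    open F using (H∞; atInfinity; ⟦_⟧; _ᗮ) renaming (_≈_ to _≈ᶠ_; _≋_ to _≋ᶠ_; _*ᵥ_ to _*ᶠ_; _-ᵥ_ to _-ᶠ_)
    open K using (_≈_; _≋_; _·_; _*ᵥ_; _-ᵥ_)
    open FieldReduction F K n order-K ι ι-isHom φ φ-isIsomorphism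
    open AffineJoin F
    open Geometry.FromDual F 𝒪

  arcVector : Vector (K.V 3) (suc K.order)
  arcVector = KA.representative ∘ O.point

  private
    x = arcVector
    open KA.PlaneArc (KA.oval⇒arc oval)

  Ψ∈dual⇔ : ∀ {i j} → ⟦ P.element i ⟧ ≐ reduced j → ∀ w → Ψ w ∈ ⟦ 𝒪.element i ⟧ ⇔ w · x j ≈ K.0#
  Ψ∈dual⇔ {i} {j} i≐j w = mk⇔
    (λ Ψw∈ → Ψ∈ᗮ⇒ {w} {K.⟦ O.point j ⟧} (λ c → KA.multiple⇒∈-point (O.point j) K.≋-refl)
               (proj₁ (ᗮ-cong F i≐j) (proj₁ (𝒪.isDual i) Ψw∈)))
    (λ w·x≈0 → proj₂ (𝒪.isDual i) (proj₂ (ᗮ-cong F i≐j)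
               (⇒Ψ∈ᗮ {w} {K.⟦ O.point j ⟧} (KA.∈-point⇒multiple (O.point j)) w·x≈0)))

  index : Fin (suc K.order) → Fin (suc (F.order ℕ.^ n))
  index j = proj₁ (reduced-element j)

  dual : Fin (suc K.order) → F.Flat (3 ℕ.* n) (2 ℕ.* n)
  dual j = 𝒪.element (index j)

  Ψ∈dual⇒ : ∀ j w → Ψ w ∈ ⟦ dual j ⟧ → w · x j ≈ K.0#
  Ψ∈dual⇒ j w = Equivalence.to (Ψ∈dual⇔ (proj₂ (reduced-element j)) w)

  ⇒Ψ∈dual : ∀ j w → w · x j ≈ K.0# → Ψ w ∈ ⟦ dual j ⟧
  ⇒Ψ∈dual j w = Equivalence.from (Ψ∈dual⇔ (proj₂ (reduced-element j)) w)

  -- The elements with indices `i` and `index j` reduce from the same point of the oval, so their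
  -- annihilators agree.
  dual-complete : ∀ i → ∃[ j ] ⟦ dual j ⟧ ≐ ⟦ 𝒪.element i ⟧
  dual-complete i = let (j , i≐j) = element-reduced i in
    j , ≐-trans (𝒪.isDual (index j)) (≐-trans
      (ᗮ-cong F (≐-trans (proj₂ (reduced-element j)) (≐-sym i≐j))) (≐-sym (𝒪.isDual i)))

  dual-injective : ∀ {i j} → ⟦ dual i ⟧ ⊆ ⟦ dual j ⟧ → i ≡ j
  dual-injective {i} {j} i⊆j = polar-injective λ w w·x≈0 → Ψ∈dual⇒ j w (i⊆j (⇒Ψ∈dual i w w·x≈0))

  -- With its converse, this makes the value at `x j` a coordinate on the cosets of `dual j`, hence
  -- on the points of the plane over `dual j`.
  difference∈⇒ : ∀ j w w′ → Ψ w -ᶠ Ψ w′ ∈ ⟦ dual j ⟧ → w · x j ≈ w′ · x j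
  difference∈⇒ j w w′ ∈dual = K.x-y≈0⇒x≈y (K.trans (K.sym (K.·-minusˡ w w′ (x j)))
    (Ψ∈dual⇒ j (w -ᵥ w′) (F.Flat.resp (dual j) (F.≋-sym (Ψ-minus w w′)) ∈dual)))

  ⇒difference∈ : ∀ j w w′ → w · x j ≈ w′ · x j → Ψ w -ᶠ Ψ w′ ∈ ⟦ dual j ⟧
  ⇒difference∈ j w w′ eq = F.Flat.resp (dual j) (Ψ-minus w w′) (⇒Ψ∈dual j (w -ᵥ w′)
    (K.trans (K.·-minusˡ w w′ (x j)) (K.x≈y⇒x-y≈0 eq)))

  opaque
    -- Any choice serves: the images under `Ψ` of two choices differ by an element of `dual j`.
    base : ∀ j t → ∃[ w ] w · x j ≈ t
    base = solve₁

  baseVector : Fin (suc K.order) → K.Carrier → F.V (3 ℕ.* n)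
  baseVector j t = Ψ (proj₁ (base j t))

  pointFlat : Fin (suc K.order) → K.Carrier → F.Flat (suc (3 ℕ.* n)) (suc (2 ℕ.* n))
  pointFlat j t = join (baseVector j t) (dual j)

  affine∈⇒ : ∀ j t w → (F.1# ∷ Ψ w) ∈ ⟦ pointFlat j t ⟧ → w · x j ≈ t
  affine∈⇒ j t w ∈join = K.trans (difference∈⇒ j w (proj₁ (base j t)) ∈join) (proj₂ (base j t))

  ⇒affine∈ : ∀ j t w → w · x j ≈ t → (F.1# ∷ Ψ w) ∈ ⟦ pointFlat j t ⟧
  ⇒affine∈ j t w w·x≈t = ⇒difference∈ j w (proj₁ (base j t)) (K.trans w·x≈t (K.sym (proj₂ (base j t))))

  lPoint : Fin (suc K.order) × K.Carrier → LPoint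
  lPoint (j , t) = record { flat = pointFlat j t ; meets-H∞ = index j , join∩H∞ (baseVector j t) (dual j) }

  pointFlat-cong : ∀ j {t t′} → t ≈ t′ → ⟦ pointFlat j t ⟧ ⊆ ⟦ pointFlat j t′ ⟧
  pointFlat-cong j {t} {t′} t≈t′ {y} = join-⊆ (baseVector j t) (baseVector j t′) (dual j) (dual j) id
    (⇒difference∈ j (proj₁ (base j t)) (proj₁ (base j t′))
      (K.trans (proj₂ (base j t)) (K.trans t≈t′ (K.sym (proj₂ (base j t′)))))) {y}

  atInfinity⊆⇒≡ : ∀ i j t → atInfinity ⟦ dual i ⟧ ⊆ ⟦ pointFlat j t ⟧ → i ≡ j
  atInfinity⊆⇒≡ i j t ⊆join = dual-injective λ {u} u∈ →
    proj₂ (proj₁ (join∩H∞ (baseVector j t) (dual j)) {F.0# ∷ u} (⊆join {F.0# ∷ u} (F.refl , u∈) , F.refl))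

  atInfinity⊆pointFlat : ∀ j t → atInfinity ⟦ dual j ⟧ ⊆ ⟦ pointFlat j t ⟧
  atInfinity⊆pointFlat j t {y} y∈ = proj₁ (proj₂ (join∩H∞ (baseVector j t) (dual j)) {y} y∈)

  -- The part at infinity recovers the index, and any affine vector `1# ∷ Ψ w` of the flat then
  -- recovers the value.
  pointFlat-injective : ∀ i t j t′ → ⟦ pointFlat i t ⟧ ⊆ ⟦ pointFlat j t′ ⟧ → i ≡ j × t ≈ t′
  pointFlat-injective i t j t′ ⊆ⱼ
    with atInfinity⊆⇒≡ i j t′ (λ {y} y∈ → ⊆ⱼ {y} (atInfinity⊆pointFlat i t {y} y∈))
  ... | ≡.refl = ≡.refl , K.trans (K.sym w·x≈t) (affine∈⇒ i t′ w (⊆ⱼ {F.1# ∷ Ψ w} (⇒affine∈ i t w w·x≈t)))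
    where
    w = proj₁ (base i t)
    w·x≈t = proj₂ (base i t)

  lPoint-surjective : ∀ (p : LPoint) → ∃[ a ] ⟦ pointFlat (proj₁ a) (proj₂ a) ⟧ ≐ ⟦ LPoint.flat p ⟧
  lPoint-surjective p =
    let open LPoint p
        (i , meets)  = meets-H∞
        (j , j≐i)    = dual-complete i
        (u , u∈)     = affineVector flat (𝒪.element i) meets
        (w , Ψw≋u)   = Ψ-surjective u
        Ψw∈          = F.Flat.resp flat (FA.∷-cong F.refl (F.≋-sym Ψw≋u)) u∈
        -- The affine vector found in the flat names a circle `w` through the given point; its value
        -- at `x j` is the missing coordinate.
        t            = w · x j
        (w₀ , w₀·x≈) = base j t
    in (j , t) , ≐-trans
         ( (λ {y} → join-⊆ (Ψ w₀) (Ψ w) (dual j) (𝒪.element i) (proj₁ j≐i)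
             (proj₁ j≐i (⇒difference∈ j w₀ w w₀·x≈)) {y})
         , (λ {y} → join-⊆ (Ψ w) (Ψ w₀) (𝒪.element i) (dual j) (proj₂ j≐i)
             (⇒difference∈ j w w₀ (K.sym w₀·x≈)) {y}))
         (≐-sym (≐-join flat (𝒪.element i) meets Ψw∈))

  lPoints : Inverse (IncidenceStructure.points (KA.arcPlane x)) (IncidenceStructure.points structure)
  lPoints = bijective⇒inverse lPoint
    (λ { {i , t} {_ , t′} (≡.refl , t≈t′) →
           (λ {y} → pointFlat-cong i t≈t′ {y}) , (λ {y} → pointFlat-cong i (K.sym t≈t′) {y}) })
    (λ { {i , t} {j , t′} (⊆ⱼ , _) → pointFlat-injective i t j t′ (λ {y} → ⊆ⱼ {y}) })
    lPoint-surjective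

  lLines : Inverse (IncidenceStructure.lines (KA.arcPlane x)) (IncidenceStructure.lines structure)
  lLines = bijective⇒inverse
    (λ j → record { flat = dual j ; isElement = index j , id , id })
    (λ { ≡.refl → id , id })
    (λ (⊆ⱼ , _) → dual-injective ⊆ⱼ)
    (λ l → let (i , l≐i) = LLine.isElement l ; (j , j≐i) = dual-complete i in j , ≐-trans j≐i (≐-sym l≐i))

  affine≉0 : ∀ u → ¬ (F.1# ∷ u) ≋ᶠ F.0ᵥ {suc (3 ℕ.* n)}
  affine≉0 u eq = F.0≉1 (F.sym (eq zero))

  circleFlat : K.V 3 → F.Flat (suc (3 ℕ.* n)) 1
  circleFlat w = FA.point (F.1# ∷ Ψ w) (affine≉0 (Ψ w))

  lCircle : K.V 3 → LCircle
  lCircle w = record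
    { flat   = circleFlat w
    ; affine = λ flat⊆H∞ → F.0≉1 (F.sym (flat⊆H∞ (FA.representative∈ (circleFlat w))))
    }

  circleFlat-⊆ : ∀ {w w′} → w ≋ w′ → ⟦ circleFlat w ⟧ ⊆ ⟦ circleFlat w′ ⟧
  circleFlat-⊆ {w} {w′} w≋w′ (c , u≋) =
    c , F.≋-trans u≋ (F.*ᵥ-cong F.refl (FA.∷-cong F.refl (Ψ-cong w≋w′)))

  circleFlat-injective : ∀ w w′ → ⟦ circleFlat w ⟧ ⊆ ⟦ circleFlat w′ ⟧ → w ≋ w′
  circleFlat-injective w w′ ⊆w′ =
    let (c , eq) = ⊆w′ (FA.representative∈ (circleFlat w))
        -- Both spanning vectors start with 1, so the factor between them is 1.
        1≈c      = F.trans (eq zero) (F.*-identityʳ c)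
    in Ψ-injective λ j → F.trans (eq (suc j)) (F.trans (F.*-congʳ (F.sym 1≈c)) (F.*-identityˡ _))

  lCircle-surjective : ∀ (k : LCircle) → ∃[ w ] ⟦ circleFlat w ⟧ ≐ ⟦ LCircle.flat k ⟧
  lCircle-surjective k =
    let open LCircle k
        r = FA.representative flat
        h≉0 : ¬ r zero ≈ᶠ F.0#
        h≉0 h≈0 = affine λ u∈ → let (c , u≋) = FA.∈-point⇒multiple flat u∈ in
          F.trans (u≋ zero) (F.trans (F.*-congˡ h≈0) (F.zeroʳ c))
        (z , hz≈1) = F.inverse (r zero) h≉0
        (w , Ψw≋)  = Ψ-surjective (z *ᶠ tail r)
    in w , FA.multiple⇒≐ (circleFlat w) flat (FA.multiple⇒∈-point flat {c = z} λ
      { zero    → F.trans (F.sym hz≈1) (F.*-comm (r zero) z)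
      ; (suc j) → Ψw≋ j })

  lCircles : Inverse (IncidenceStructure.circles (KA.arcPlane x)) (IncidenceStructure.circles structure)
  lCircles = bijective⇒inverse lCircle
    (λ w≋w′ → circleFlat-⊆ w≋w′ , circleFlat-⊆ (K.≋-sym w≋w′))
    (λ {w} {w′} (⊆w′ , _) → circleFlat-injective w w′ ⊆w′)
    lCircle-surjective

  onLine⇔ : ∀ i t l → i ≡ l ⇔ (atInfinity ⟦ dual l ⟧ ⊆ ⟦ pointFlat i t ⟧)
  onLine⇔ i t l = mk⇔ (λ { ≡.refl {y} → atInfinity⊆pointFlat i t {y} }) (λ l⊆ → ≡.sym (atInfinity⊆⇒≡ l i t (λ {y} → l⊆ {y})))

  onCircle⇔ : ∀ i t w → w · x i ≈ t ⇔ (⟦ circleFlat w ⟧ ⊆ ⟦ pointFlat i t ⟧)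
  onCircle⇔ i t w = mk⇔
    (λ w·x≈t {y} → FA.point-⊆ (circleFlat w) (pointFlat i t) (⇒affine∈ i t w w·x≈t) {y})
    (λ w⊆ → affine∈⇒ i t w (w⊆ (FA.representative∈ (circleFlat w))))

  arcPlane≅dual : Isomorphism (KA.arcPlane x) structure
  arcPlane≅dual = record
    { onPoints   = lPoints
    ; onLines    = lLines
    ; onCircles  = lCircles
    ; onLine-⇔   = λ (i , t) → onLine⇔ i t
    ; onCircle-⇔ = λ (i , t) → onCircle⇔ i t
    }

-- An arc in K³ as an elementary pseudo-oval with n = 1

module StandardPseudoOval (F : FiniteField) where
  open LinearAlgebra F
  open Arcs F

  -- Pairing a relation with `b (suc j)` isolates its j-th coefficient.
  dualBasis-independent : ∀ {m} {b : Vector (V (suc m)) (suc m)} (d : Vector (V (suc m)) m) →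
                          (∀ i j → d i · b (suc j) ≈ δ i j) → Independent d
  dualBasis-independent {b = b} d d·b≈δ = independent λ a eq j → begin
    a j                                ≈⟨ combination-δ a j ⟨
    sum (λ i → a i * δ i j)            ≈⟨ sum-cong-≋ (λ i → *-congˡ (trans (·-comm (b (suc j)) (d i)) (d·b≈δ i j))) ⟨
    sum (λ i → a i * (b (suc j) · d i)) ≈⟨ ·-combination (b (suc j)) a d ⟨
    b (suc j) · combination a d        ≈⟨ ·-cong (≋-refl {x = b (suc j)}) eq ⟩
    b (suc j) · 0ᵥ                     ≈⟨ ·-zeroʳ (b (suc j)) ⟩
    0#                                 ∎
    where open ≈-R

  -- The annihilator of `b zero`, with the basis dual to `b` after its first member is dropped; the
  -- coefficients of `u` are its values on the other `b (suc i)`.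
  hyperplane : ∀ {m} (b : Vector (V (suc m)) (suc m)) → Independent b → Flat (suc m) m
  hyperplane {m} b ind = record
    { subspace = record
      { carrier  = λ u → u · b zero ≈ 0#
      ; resp     = λ u≋v u· → trans (·-cong (≋-sym u≋v) (≋-refl {x = b zero})) u·
      ; 0-closed = ·-zeroˡ (b zero)
      ; +-closed = λ {u} {v} u· v· → trans (·-+ˡ u v (b zero)) (trans (+-cong u· v·) (+-identityʳ 0#))
      ; *-closed = λ c {u} u· → trans (·-*ˡ c u (b zero)) (trans (*-congˡ u·) (zeroʳ c))
      }
    ; basis = record
      { vectors     = d
      ; inside      = λ i → d·b≈δ i zero
      ; independent = trivial (dualBasis-independent {b = b} d λ i j → d·b≈δ i (suc j))
      ; spanning    = λ {u} u· → (λ i → u · b (suc i)) , dual-separates ind λ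
          { zero    → trans u· (sym (trans (pair u zero) (sum-zero {m} {λ i → (u · b (suc i)) * 0#} λ i → zeroʳ _)))
          ; (suc j) → sym (trans (pair u (suc j)) (combination-δ (λ i → u · b (suc i)) j)) }
      }
    }
    where
    d : Vector (V (suc m)) m
    d i = proj₁ (dual-solution ind (δ (suc i)))
    d·b≈δ : ∀ i j → d i · b j ≈ δ (suc i) j
    d·b≈δ i = proj₂ (dual-solution ind (δ (suc i)))
    pair : ∀ u j → combination (λ i → u · b (suc i)) d · b j ≈ sum (λ i → (u · b (suc i)) * δ (suc i) j)
    pair u j = begin
      combination (λ i → u · b (suc i)) d · b j          ≈⟨ ·-comm (combination (λ i → u · b (suc i)) d) (b j) ⟩
      b j · combination (λ i → u · b (suc i)) d          ≈⟨ ·-combination (b j) _ d ⟩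
      sum (λ i → (u · b (suc i)) * (b j · d i))          ≈⟨ sum-cong-≋ (λ i → *-congˡ (trans (·-comm (b j) (d i)) (d·b≈δ i j))) ⟩
      sum (λ i → (u · b (suc i)) * δ (suc i) j)          ∎
      where open ≈-R

  module _ (x : Vector (V 3) (suc order)) (arc : Arc x) where
    open ArcProperties arc

    private
      -- `order ^ 1` unfolds to `order * 1`, which equals `order` only propositionally, so indices
      -- are cast.
      size : suc (order ℕ.^ 1) ≡ suc order
      size = ≡.cong ℕ.suc (ℕ.*-identityʳ order)

      to : Fin (suc (order ℕ.^ 1)) → Fin (suc order)
      to = Fin.cast size

      from : Fin (suc order) → Fin (suc (order ℕ.^ 1))
      from = Fin.cast (≡.sym size)

      to-injective : ∀ {i j} → to i ≡ to j → i ≡ j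
      to-injective {i} {j} eq = ≡.trans (≡.sym (Fin.cast-involutive (≡.sym size) size i))
        (≡.trans (≡.cong from eq) (Fin.cast-involutive (≡.sym size) size j))

      arcPoint : Fin (suc order) → Flat 3 1
      arcPoint i = point (x i) (arc-nonzero i)

    -- The two further arc vectors merely complete `x i` to a basis of K³; they affect the basis of
    -- the line but not its vectors.
    polarLine : Fin (suc order) → Flat 3 2
    polarLine i =
      let (j , i≢j)       = ∃-≢ (ℕ.<⇒≤ 2≤order) i
          (k , i≢k , j≢k) = ∃-≢₂ 2≤order i≢j
      in hyperplane (x i ∷ x j ∷ x k ∷ []) (arc i≢j i≢k j≢k)

    polarLine≐ : ∀ i → ⟦ polarLine i ⟧ ≐ ⟦ arcPoint i ⟧ ᗮ
    polarLine≐ i =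
        (λ {u} u·x≈0 {y} (c , y≋cx) → trans (·-comm y u) (trans (·-cong (≋-refl {x = u}) y≋cx)
          (trans (·-*ʳ c u (x i)) (trans (*-congˡ u·x≈0) (zeroʳ c)))))
      , (λ {u} u∈ᗮ → trans (·-comm u (x i)) (u∈ᗮ (representative∈ (arcPoint i))))

    pseudoOval : PseudoOval 1
    pseudoOval = record
      { element   = arcPoint ∘ to
      ; distinct  = λ (⊆ⱼ , _) → to-injective (arc-injective (proj₂ (⊆ⱼ (representative∈ (arcPoint _)))))
      ; threeSpan = λ {i} {j} {k} i≢j i≢k j≢k {u} _ →
          let (a , ≋u) = independent⇒spanning
                (arc (i≢j ∘ to-injective) (i≢k ∘ to-injective) (j≢k ∘ to-injective)) u
              a₀ = a zero
              a₁ = a (suc zero)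
              a₂ = a (suc (suc zero))
              xi = x (to i)
              xj = x (to j)
              xk = x (to k)
          in a₀ *ᵥ xi +ᵥ a₁ *ᵥ xj , a₂ *ᵥ xk ,
             (a₀ *ᵥ xi , a₁ *ᵥ xj , (a₀ , ≋-refl) , (a₁ , ≋-refl) , ≋-refl) , (a₂ , ≋-refl) ,
             λ h → trans (sym (≋u h)) (trans (+-congˡ (+-congˡ (+-identityʳ _))) (sym (+-assoc _ _ _)))
      }

    dualPseudoOval : DualPseudoOval 1
    dualPseudoOval = record
      { pseudoOval = pseudoOval
      ; element    = polarLine ∘ to
      ; isDual     = polarLine≐ ∘ to
      }

    -- Field reduction from F to itself changes nothing, and `3 * 1` computes to 3, so the identity
    -- serves as `φ`.
    isElementary : IsElementary pseudoOval
    isElementary = record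
      { K               = F
      ; order-K         = ≡.sym (ℕ.*-identityʳ order)
      ; ι               = id
      ; ι-isHom         = RingIdentity.isRingHomomorphism rawRing refl
      ; φ               = id
      ; φ-isIsomorphism = ModuleIdentity.isLeftModuleIsomorphism (restrictScalars F F id 3) ≋-refl
      ; oval            = arc⇒oval (λ _ _ → tt) (λ _ _ → tt)
      ; element-reduced = λ i → to i , reduced≐ (to i)
      ; reduced-element = λ j → from j ,
          ≡.subst (λ i → ⟦ arcPoint i ⟧ ≐ reduced j) (≡.sym (Fin.cast-involutive size (≡.sym size) j)) (reduced≐ j)
      }
      where
      reduced : Fin (suc order) → Pred (V 3) 0ℓ
      reduced j y = ∃[ u ] (u ∈ ⟦ arcPoint j ⟧ × u ≋ y)
      reduced≐ : ∀ j → ⟦ arcPoint j ⟧ ≐ reduced j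
      reduced≐ j = (λ {u} u∈ → u , u∈ , ≋-refl) , (λ (u , u∈ , u≋y) → Flat.resp (arcPoint j) u≋y u∈)

-- A cone over a given arc

module StandardCone (F : FiniteField) where
  open LinearAlgebra F
  open Arcs F

  vertex : Flat 4 1
  vertex = point (δ zero) λ eq → 0≉1 (sym (eq zero))

  tail-independent : Independent (δ {4} ∘ suc)
  tail-independent = independent λ a eq j → trans (sym (combination-δ a j)) (eq (suc j))

  π : Flat 4 3
  π = span (δ ∘ suc) tail-independent

  vertex⊈π : ⟦ vertex ⟧ ⊈ ⟦ π ⟧
  vertex⊈π vertex⊆π = let (a , eq) = vertex⊆π (representative∈ vertex) in
    0≉1 (sym (trans (eq zero) (sum-zero λ i → zeroʳ (a i))))

  module _ (x : Vector (V 3) (suc order)) (arc : Arc x) where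

    base : Oval ⟦ π ⟧
    base = ArcProperties.arc⇒oval {x = λ i → combination (x i) (δ ∘ suc)}
      (arc-image (δ ∘ suc) x tail-independent arc)
      (λ i c → c *ᵥ x i , ≋-sym (combination-* c (x i) (δ ∘ suc)))
      (Flat.resp π)

-- Joining the two comparisons through the model plane

theorem2p4 : ∀ {c ℓ i} (𝕃 : IncidenceStructure c ℓ i) →
    IsLaguerrePlane 𝕃 → IsFiniteStructure 𝕃 → IsElation 𝕃 →
    IsOvoidal 𝕃 ⇔ IsFromElementaryDual 𝕃
theorem2p4 𝕃 _ _ _ = mk⇔ ovoidal⇒elementary elementary⇒ovoidal
  where
  ovoidal⇒elementary : IsOvoidal 𝕃 → IsFromElementaryDual 𝕃
  ovoidal⇒elementary (F , vertex , π , base , vertex⊈π , 𝕃≅cone) =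
      F , 1 , dualPseudoOval x arc , s≤s z≤n , isElementary x arc ,
      -- The two isomorphisms meet in the same model: the oval made from `x` has the vectors `x i`
      -- themselves as representatives.
      ≅-trans 𝕃≅cone (≅-trans
        (≅-sym (ConeCoordinates.arcPlane≅cone F vertex π base vertex⊈π x arc x-coordinates))
        (ElementaryDual.arcPlane≅dual (dualPseudoOval x arc) (isElementary x arc)))
    where
    open LinearAlgebra F
    open Arcs F
    open StandardPseudoOval F
    coordinates : ∀ i → ∃[ a ] representative (Oval.point base i) ≋ combination a (Basis.vectors (Flat.basis π))
    coordinates i = Basis.spanning (Flat.basis π) (Oval.inPlane base i (representative∈ (Oval.point base i)))
    x : Vector (V 3) (suc order)
    x = proj₁ ∘ coordinates
    x-coordinates = proj₂ ∘ coordinates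
    arc : Arc x
    arc = arc-preimage (Basis.vectors (Flat.basis π)) x (arc-cong x-coordinates (oval⇒arc base))

  elementary⇒ovoidal : IsFromElementaryDual 𝕃 → IsOvoidal 𝕃
  elementary⇒ovoidal (F , n , 𝒪 , _ , elementary , 𝕃≅L) =
      K , vertex , π , base x arc , vertex⊈π ,
      ≅-trans 𝕃≅L (≅-trans (≅-sym (ElementaryDual.arcPlane≅dual 𝒪 elementary))
        -- The base was built by placing `x` on the basis of `π`, so its coordinates are `x` by
        -- definition.
        (ConeCoordinates.arcPlane≅cone K vertex π (base x arc) vertex⊈π x arc λ _ → ≋-refl))
    where
    open IsElementary elementary using (K; oval)
    open LinearAlgebra K
    open Arcs K
    open StandardCone K
    x : Vector (V 3) (suc order)
    x = ElementaryDual.arcVector 𝒪 elementary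
    arc : Arc x
    arc = oval⇒arc oval
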